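{- Let $p$ be an odd prime and let $g\in G$, $g\neq 1$, be represented by a matrix $\begin{bmatrix}a&b\\c&d\end{bmatrix}\in\mathrm{GL}_2(\mathbb{Z})$ with $N:=\max(|a|,|b|,|c|,|d|)\le (p/128)^{1/8}$. Then $g$ has at most $1024\,p\,N^8$ fixed points on $M(\mathbb{F}_p)$.
   Context: $M(\mathbb{F}_p)$ denotes the set of triples $(x,y,z)\in\mathbb{F}_p^3\setminus\{(0,0,0)\}$ satisfying $x^2+y^2+z^2=xyz$. The Markoff moves are the maps $m_1(x,y,z)=(yz-x,y,z)$, $m_2(x,y,z)=(x,xz-y,z)$, $m_3(x,y,z)=(x,y,xy-z)$ on $M(\mathbb{F}_p)$. Let $G=\mathbb{Z}/2*\mathbb{Z}/2*\mathbb{Z}/2$ be the free product with generators $m_1,m_2,m_3$; it acts on $M(\mathbb{F}_p)$ with $m_i$ acting by the $i$-th Markoff move. There is an injective homomorphism $G\to\mathrm{PGL}_2(\mathbb{Z})$ sending $m_1,m_2,m_3$ to the classes of $\begin{bmatrix}1&0\\2&-1\end{bmatrix}$, $\begin{bmatrix}-1&2\\0&1\end{bmatrix}$, $\begin{bmatrix}-1&0\\0&1\end{bmatrix}$ respectively. An element $g\in G$ is said to be represented by a matrix in $\mathrm{GL}_2(\mathbb{Z})$ if that matrix lies in the class that is the image of $g$ (the matrix is determined up to sign). -}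

module Defs where

open import Level using (0ℓ)
open import Algebra.Bundles using (Group; CommutativeRing)
open import Algebra.Morphism.Structures using (IsGroupHomomorphism)
open import Data.Fin.Base using (Fin; toℕ)
open import Data.Fin.Properties using (toℕ-injective; toℕ-fromℕ<; toℕ<n)
import Data.Fin.Properties as Fin
open import Data.Integer.Base as ℤ using (ℤ; +_; -[1+_]; 0ℤ; 1ℤ; -1ℤ)
import Data.Integer.Properties as ℤ
open import Data.Integer.Tactic.RingSolver using (solve-∀)
open import Data.List.Base
  using (List; []; _∷_; _++_; [_]; foldr; reverse; length; filter; allFin; cartesianProduct)
open import Data.List.Properties using (++-assoc; ++-identityʳ; unfold-reverse)
open import Data.Nat.Base as ℕ using (ℕ; NonZero; _⊔_)
open import Data.Nat.DivMod
  using (_%_; _mod_; m%n<n; m<n⇒m%n≡m; %-distribˡ-+; %-distribˡ-*; n%n≡0)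
import Data.Nat.Properties as ℕ
open import Data.Product.Base using (_×_; _,_)
open import Data.Product.Properties using (≡-dec)
open import Relation.Binary.Construct.Closure.Equivalence as EqC using (EqClosure)
open import Relation.Binary.Core using (Rel)
open import Relation.Binary.Definitions using (DecidableEquality)
open import Relation.Binary.PropositionalEquality
  using (_≡_; refl; sym; trans; cong; cong₂; subst₂; isEquivalence; module ≡-Reasoning)
open import Relation.Binary.Structures using (IsEquivalence)
open import Relation.Nullary using (¬_; Dec; ¬?)
open import Relation.Nullary.Decidable using (_×-dec_)

------------------------------------------------------------------------
-- The free product ℤ/2 * ℤ/2 * ℤ/2

-- Words in the generators modulo the congruence generated by mᵢmᵢ = 1: since every
-- generator is its own inverse, no formal inverses are needed.

data Generator : Set where
  m₁ m₂ m₃ : Generator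

Word : Set
Word = List Generator

data Cancels : Rel Word 0ℓ where
  cancel : ∀ u i v → Cancels (u ++ i ∷ i ∷ v) (u ++ v)

infix 4 _≈G_

_≈G_ : Rel Word 0ℓ
_≈G_ = EqClosure Cancels

private module ≈G = IsEquivalence (EqC.isEquivalence Cancels)

++-congˡ : ∀ w {u v} → u ≈G v → w ++ u ≈G w ++ v
++-congˡ w = EqC.gmap (w ++_) λ where
  (cancel u i v) → subst₂ Cancels (++-assoc w u _) (++-assoc w u v) (cancel (w ++ u) i v)

++-congʳ : ∀ w {u v} → u ≈G v → u ++ w ≈G v ++ w
++-congʳ w = EqC.gmap (_++ w) λ where
  (cancel u i v) →
    subst₂ Cancels (sym (++-assoc u _ w)) (sym (++-assoc u v w)) (cancel u i (v ++ w))

++-cong : ∀ {u v w x} → u ≈G v → w ≈G x → u ++ w ≈G v ++ x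
++-cong {v = v} {w = w} u≈v w≈x = ≈G.trans (++-congʳ w u≈v) (++-congˡ v w≈x)

reverse-inverseˡ : ∀ w → reverse w ++ w ≈G []
reverse-inverseˡ []      = ≈G.refl
reverse-inverseˡ (i ∷ w) = ≈G.trans
  (≈G.reflexive (trans (cong (_++ i ∷ w) (unfold-reverse i w))
                       (++-assoc (reverse w) [ i ] (i ∷ w))))
  (≈G.trans (EqC.return (cancel (reverse w) i w)) (reverse-inverseˡ w))

reverse-inverseʳ : ∀ w → w ++ reverse w ≈G []
reverse-inverseʳ []      = ≈G.refl
reverse-inverseʳ (i ∷ w) = ≈G.trans
  (≈G.reflexive (cong (i ∷_) (trans (cong (w ++_) (unfold-reverse i w))
                                    (sym (++-assoc w (reverse w) [ i ])))))
  (≈G.trans (++-congˡ [ i ] (++-congʳ [ i ] (reverse-inverseʳ w)))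
            (EqC.return (cancel [] i [])))

reverse-cong : ∀ {u v} → u ≈G v → reverse u ≈G reverse v
reverse-cong {u} {v} u≈v =
  ≈G.trans (≈G.reflexive (sym (++-identityʳ (reverse u))))
  (≈G.trans (++-congˡ (reverse u)
               (≈G.trans (≈G.sym (reverse-inverseʳ v)) (++-congʳ (reverse v) (≈G.sym u≈v))))
  (≈G.trans (≈G.reflexive (sym (++-assoc (reverse u) u (reverse v))))
            (++-congʳ (reverse v) (reverse-inverseˡ u))))

G : Group 0ℓ 0ℓ
G = record
  { Carrier = Word
  ; _≈_     = _≈G_
  ; _∙_     = _++_
  ; ε       = []
  ; _⁻¹     = reverse
  ; isGroup = record
    { isMonoid = record
      { isSemigroup = record
        { isMagma = record
          { isEquivalence = EqC.isEquivalence Cancels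
          ; ∙-cong        = ++-cong
          }
        ; assoc = λ u v w → ≈G.reflexive (++-assoc u v w)
        }
      ; identity = (λ _ → ≈G.refl) , λ w → ≈G.reflexive (++-identityʳ w)
      }
    ; inverse = reverse-inverseˡ , reverse-inverseʳ
    ; ⁻¹-cong = reverse-cong
    }
  }

------------------------------------------------------------------------
-- GL₂(ℤ) and PGL₂(ℤ)

-- Without η, products of variable matrices are not compared entrywise.
record Matrix : Set where
  no-eta-equality
  pattern
  constructor mat
  field a b c d : ℤ

det : Matrix → ℤ
det (mat a b c d) = a ℤ.* d ℤ.- b ℤ.* c

infixl 7 _·_

_·_ : Matrix → Matrix → Matrix
A · B = mat (A.a ℤ.* B.a ℤ.+ A.b ℤ.* B.c) (A.a ℤ.* B.b ℤ.+ A.b ℤ.* B.d)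
            (A.c ℤ.* B.a ℤ.+ A.d ℤ.* B.c) (A.c ℤ.* B.b ℤ.+ A.d ℤ.* B.d)
  where
  module A = Matrix A
  module B = Matrix B

1M : Matrix
1M = mat 1ℤ 0ℤ 0ℤ 1ℤ

neg : Matrix → Matrix
neg (mat a b c d) = mat (ℤ.- a) (ℤ.- b) (ℤ.- c) (ℤ.- d)

adj : Matrix → Matrix
adj (mat a b c d) = mat d (ℤ.- b) (ℤ.- c) a

-- The units of ℤ are the integers of absolute value 1.
record GL₂ℤ : Set where
  no-eta-equality
  pattern
  constructor gl
  field
    matrix   : Matrix
    det-unit : ℤ.∣ det matrix ∣ ≡ 1

open GL₂ℤ public

-- Equality in PGL₂(ℤ) = GL₂(ℤ)/{±1}.
infix 4 _≈P_

data _≈P_ (A B : GL₂ℤ) : Set where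
  same     : matrix A ≡ matrix B → A ≈P B
  opposite : matrix A ≡ neg (matrix B) → A ≈P B

mat-cong : ∀ {a b c d a′ b′ c′ d′} → a ≡ a′ → b ≡ b′ → c ≡ c′ → d ≡ d′ →
           mat a b c d ≡ mat a′ b′ c′ d′
mat-cong refl refl refl refl = refl

·-assoc : ∀ A B C → (A · B) · C ≡ A · (B · C)
·-assoc A B C =
  mat-cong (lem A.a A.b B.a B.b B.c B.d C.a C.c) (lem A.a A.b B.a B.b B.c B.d C.b C.d)
           (lem A.c A.d B.a B.b B.c B.d C.a C.c) (lem A.c A.d B.a B.b B.c B.d C.b C.d)
  where
  module A = Matrix A
  module B = Matrix B
  module C = Matrix C
  lem : ∀ a b a′ b′ c′ d′ x y →
        (a ℤ.* a′ ℤ.+ b ℤ.* c′) ℤ.* x ℤ.+ (a ℤ.* b′ ℤ.+ b ℤ.* d′) ℤ.* y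
        ≡ a ℤ.* (a′ ℤ.* x ℤ.+ b′ ℤ.* y) ℤ.+ b ℤ.* (c′ ℤ.* x ℤ.+ d′ ℤ.* y)
  lem = solve-∀

·-identityˡ : ∀ A → 1M · A ≡ A
·-identityˡ (mat a b c d) = mat-cong (l a c) (l b d) (r a c) (r b d)
  where
  l : ∀ x y → 1ℤ ℤ.* x ℤ.+ 0ℤ ℤ.* y ≡ x
  l = solve-∀
  r : ∀ x y → 0ℤ ℤ.* x ℤ.+ 1ℤ ℤ.* y ≡ y
  r = solve-∀

·-identityʳ : ∀ A → A · 1M ≡ A
·-identityʳ (mat a b c d) = mat-cong (l a b) (r a b) (l c d) (r c d)
  where
  l : ∀ x y → x ℤ.* 1ℤ ℤ.+ y ℤ.* 0ℤ ≡ x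
  l = solve-∀
  r : ∀ x y → x ℤ.* 0ℤ ℤ.+ y ℤ.* 1ℤ ≡ y
  r = solve-∀

neg-·ˡ : ∀ A B → neg A · B ≡ neg (A · B)
neg-·ˡ (mat a b c d) (mat a′ b′ c′ d′) =
  mat-cong (lem a b a′ c′) (lem a b b′ d′) (lem c d a′ c′) (lem c d b′ d′)
  where
  lem : ∀ a b x y → (ℤ.- a) ℤ.* x ℤ.+ (ℤ.- b) ℤ.* y ≡ ℤ.- (a ℤ.* x ℤ.+ b ℤ.* y)
  lem = solve-∀

neg-·ʳ : ∀ A B → A · neg B ≡ neg (A · B)
neg-·ʳ (mat a b c d) (mat a′ b′ c′ d′) =
  mat-cong (lem a b a′ c′) (lem a b b′ d′) (lem c d a′ c′) (lem c d b′ d′)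
  where
  lem : ∀ a b x y → a ℤ.* (ℤ.- x) ℤ.+ b ℤ.* (ℤ.- y) ≡ ℤ.- (a ℤ.* x ℤ.+ b ℤ.* y)
  lem = solve-∀

neg-involutive : ∀ A → neg (neg A) ≡ A
neg-involutive (mat a b c d) =
  mat-cong (ℤ.neg-involutive a) (ℤ.neg-involutive b)
           (ℤ.neg-involutive c) (ℤ.neg-involutive d)

adj-neg : ∀ A → adj (neg A) ≡ neg (adj A)
adj-neg (mat a b c d) = refl

adj-· : ∀ A → adj A · A ≡ mat (det A) 0ℤ 0ℤ (det A)
adj-· (mat a b c d) = mat-cong (p a b c d) (q b d) (r a c) (s a b c d)
  where
  p : ∀ a b c d → d ℤ.* a ℤ.+ (ℤ.- b) ℤ.* c ≡ a ℤ.* d ℤ.+ ℤ.- (b ℤ.* c)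
  p = solve-∀
  q : ∀ b d → d ℤ.* b ℤ.+ (ℤ.- b) ℤ.* d ≡ 0ℤ
  q = solve-∀
  r : ∀ a c → (ℤ.- c) ℤ.* a ℤ.+ a ℤ.* c ≡ 0ℤ
  r = solve-∀
  s : ∀ a b c d → (ℤ.- c) ℤ.* b ℤ.+ a ℤ.* d ≡ a ℤ.* d ℤ.+ ℤ.- (b ℤ.* c)
  s = solve-∀

·-adj : ∀ A → A · adj A ≡ mat (det A) 0ℤ 0ℤ (det A)
·-adj (mat a b c d) = mat-cong (p a b c d) (q a b) (r c d) (s a b c d)
  where
  p : ∀ a b c d → a ℤ.* d ℤ.+ b ℤ.* (ℤ.- c) ≡ a ℤ.* d ℤ.+ ℤ.- (b ℤ.* c)
  p = solve-∀
  q : ∀ a b → a ℤ.* (ℤ.- b) ℤ.+ b ℤ.* a ≡ 0ℤ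
  q = solve-∀
  r : ∀ c d → c ℤ.* d ℤ.+ d ℤ.* (ℤ.- c) ≡ 0ℤ
  r = solve-∀
  s : ∀ a b c d → c ℤ.* (ℤ.- b) ℤ.+ d ℤ.* a ≡ a ℤ.* d ℤ.+ ℤ.- (b ℤ.* c)
  s = solve-∀

det-· : ∀ A B → det (A · B) ≡ det A ℤ.* det B
det-· (mat a b c d) (mat a′ b′ c′ d′) = lem a b c d a′ b′ c′ d′
  where
  lem : ∀ a b c d a′ b′ c′ d′ →
        (a ℤ.* a′ ℤ.+ b ℤ.* c′) ℤ.* (c ℤ.* b′ ℤ.+ d ℤ.* d′)
          ℤ.+ ℤ.- ((a ℤ.* b′ ℤ.+ b ℤ.* d′) ℤ.* (c ℤ.* a′ ℤ.+ d ℤ.* c′))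
        ≡ (a ℤ.* d ℤ.+ ℤ.- (b ℤ.* c)) ℤ.* (a′ ℤ.* d′ ℤ.+ ℤ.- (b′ ℤ.* c′))
  lem = solve-∀

det-adj : ∀ A → det (adj A) ≡ det A
det-adj (mat a b c d) = lem a b c d
  where
  lem : ∀ a b c d → d ℤ.* a ℤ.+ ℤ.- ((ℤ.- b) ℤ.* (ℤ.- c)) ≡ a ℤ.* d ℤ.+ ℤ.- (b ℤ.* c)
  lem = solve-∀

≈P-scalar : ∀ {A} x → ℤ.∣ x ∣ ≡ 1 → matrix A ≡ mat x 0ℤ 0ℤ x → A ≈P gl 1M refl
≈P-scalar (+ 1)    refl e = same e
≈P-scalar -[1+ 0 ] refl e = opposite e

≈P-isEquivalence : IsEquivalence _≈P_
≈P-isEquivalence = record { refl = same refl ; sym = symP ; trans = transP }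
  where
  symP : ∀ {A B} → A ≈P B → B ≈P A
  symP (same e) = same (sym e)
  symP {B = B} (opposite e) = opposite (trans (sym (neg-involutive (matrix B))) (cong neg (sym e)))

  transP : ∀ {A B C} → A ≈P B → B ≈P C → A ≈P C
  transP (same e) (same f) = same (trans e f)
  transP (same e) (opposite f) = opposite (trans e f)
  transP (opposite e) (same f) = opposite (trans e (cong neg f))
  transP {C = C} (opposite e) (opposite f) =
    same (trans e (trans (cong neg f) (neg-involutive (matrix C))))

private module ≈P = IsEquivalence ≈P-isEquivalence

infixl 7 _∙P_

_∙P_ : GL₂ℤ → GL₂ℤ → GL₂ℤ
A ∙P B = gl (matrix A · matrix B) (begin
  ℤ.∣ det (matrix A · matrix B) ∣             ≡⟨ cong ℤ.∣_∣ (det-· (matrix A) (matrix B)) ⟩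
  ℤ.∣ det (matrix A) ℤ.* det (matrix B) ∣     ≡⟨ ℤ.abs-* (det (matrix A)) (det (matrix B)) ⟩
  ℤ.∣ det (matrix A) ∣ ℕ.* ℤ.∣ det (matrix B) ∣ ≡⟨ cong₂ ℕ._*_ (det-unit A) (det-unit B) ⟩
  1                                           ∎)
  where open ≡-Reasoning

∙P-cong : ∀ {A B C D} → A ≈P B → C ≈P D → A ∙P C ≈P B ∙P D
∙P-cong (same e) (same f) = same (cong₂ _·_ e f)
∙P-cong {B = B} {D = D} (same e) (opposite f) =
  opposite (trans (cong₂ _·_ e f) (neg-·ʳ (matrix B) (matrix D)))
∙P-cong {B = B} {D = D} (opposite e) (same f) =
  opposite (trans (cong₂ _·_ e f) (neg-·ˡ (matrix B) (matrix D)))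
∙P-cong {B = B} {D = D} (opposite e) (opposite f) = same (begin
  _                                       ≡⟨ cong₂ _·_ e f ⟩
  neg (matrix B) · neg (matrix D)         ≡⟨ neg-·ˡ (matrix B) (neg (matrix D)) ⟩
  neg (matrix B · neg (matrix D))         ≡⟨ cong neg (neg-·ʳ (matrix B) (matrix D)) ⟩
  neg (neg (matrix B · matrix D))         ≡⟨ neg-involutive (matrix B · matrix D) ⟩
  matrix B · matrix D                     ∎)
  where open ≡-Reasoning

-- The adjugate is ± the inverse matrix, hence the inverse in PGL₂(ℤ).
PGL₂ℤ : Group 0ℓ 0ℓ
PGL₂ℤ = record
  { Carrier = GL₂ℤ
  ; _≈_     = _≈P_
  ; _∙_     = _∙P_
  ; ε       = gl 1M refl
  ; _⁻¹     = λ A → gl (adj (matrix A)) (trans (cong ℤ.∣_∣ (det-adj (matrix A))) (det-unit A))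
  ; isGroup = record
    { isMonoid = record
      { isSemigroup = record
        { isMagma = record
          { isEquivalence = ≈P-isEquivalence
          ; ∙-cong        = ∙P-cong
          }
        ; assoc = λ A B C → same (·-assoc (matrix A) (matrix B) (matrix C))
        }
      ; identity = (λ A → same (·-identityˡ (matrix A))) , λ A → same (·-identityʳ (matrix A))
      }
    ; inverse = (λ A → ≈P-scalar (det (matrix A)) (det-unit A) (adj-· (matrix A)))
              , λ A → ≈P-scalar (det (matrix A)) (det-unit A) (·-adj (matrix A))
    ; ⁻¹-cong = λ where
        (same e)             → same (cong adj e)
        {y = B} (opposite e) → opposite (trans (cong adj e) (adj-neg (matrix B)))
    }
  }

generatorMatrix : Generator → GL₂ℤ
generatorMatrix m₁ = gl (mat 1ℤ 0ℤ (+ 2) -1ℤ) refl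
generatorMatrix m₂ = gl (mat -1ℤ (+ 2) 0ℤ 1ℤ) refl
generatorMatrix m₃ = gl (mat -1ℤ 0ℤ 0ℤ 1ℤ) refl

ρ : Word → GL₂ℤ
ρ = foldr (λ i A → generatorMatrix i ∙P A) (Group.ε PGL₂ℤ)

ρ-++ : ∀ u v → ρ (u ++ v) ≈P ρ u ∙P ρ v
ρ-++ []      v = same (sym (·-identityˡ (matrix (ρ v))))
ρ-++ (i ∷ u) v = ≈P.trans
  (∙P-cong (≈P.refl {M}) (ρ-++ u v))
  (same (sym (·-assoc (matrix M) (matrix (ρ u)) (matrix (ρ v)))))
  where M = generatorMatrix i

generatorMatrix² : ∀ i → matrix (generatorMatrix i) · matrix (generatorMatrix i) ≡ 1M
generatorMatrix² m₁ = refl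
generatorMatrix² m₂ = refl
generatorMatrix² m₃ = refl

ρ-cancel : ∀ {u v} → Cancels u v → ρ u ≈P ρ v
ρ-cancel (cancel [] i v) = same (begin
  M · (M · matrix (ρ v))   ≡⟨ ·-assoc M M (matrix (ρ v)) ⟨
  (M · M) · matrix (ρ v)   ≡⟨ cong (_· matrix (ρ v)) (generatorMatrix² i) ⟩
  1M · matrix (ρ v)        ≡⟨ ·-identityˡ (matrix (ρ v)) ⟩
  matrix (ρ v)             ∎)
  where
  open ≡-Reasoning
  M = matrix (generatorMatrix i)
ρ-cancel (cancel (j ∷ u) i v) = ∙P-cong (≈P.refl {generatorMatrix j}) (ρ-cancel (cancel u i v))

ρ-cong : ∀ {u v} → u ≈G v → ρ u ≈P ρ v
ρ-cong = EqC.gfold ≈P-isEquivalence ρ ρ-cancel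

ρ-isGroupHomomorphism : IsGroupHomomorphism (Group.rawGroup G) (Group.rawGroup PGL₂ℤ) ρ
ρ-isGroupHomomorphism = record
  { isMonoidHomomorphism = record
    { isMagmaHomomorphism = record
      { isRelHomomorphism = record { cong = ρ-cong }
      ; homo = ρ-++
      }
    ; ε-homo = ≈P.refl
    }
  ; ⁻¹-homo = λ w → inverseˡ-unique (ρ (reverse w)) (ρ w)
      (≈P.trans (≈P.sym (ρ-++ (reverse w) w)) (ρ-cong (reverse-inverseˡ w)))
  }
  where open import Algebra.Properties.Group PGL₂ℤ using (inverseˡ-unique)

infix 4 _RepresentedBy_

_RepresentedBy_ : Group.Carrier G → GL₂ℤ → Set
g RepresentedBy A = ρ g ≈P A

maxEntry : GL₂ℤ → ℕ
maxEntry (gl (mat a b c d) _) = ℤ.∣ a ∣ ⊔ ℤ.∣ b ∣ ⊔ ℤ.∣ c ∣ ⊔ ℤ.∣ d ∣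

------------------------------------------------------------------------
-- Arithmetic of ℤ/p on the residues 0, …, p − 1

module Residue (p : ℕ) .{{_ : NonZero p}} where

  ι : ℕ → Fin p
  ι n = n mod p

  toℕ-ι : ∀ n → toℕ (ι n) ≡ n % p
  toℕ-ι n = toℕ-fromℕ< (m%n<n n p)

  ι-toℕ : ∀ x → ι (toℕ x) ≡ x
  ι-toℕ x = toℕ-injective (trans (toℕ-ι (toℕ x)) (m<n⇒m%n≡m (toℕ<n x)))

  ι-cong% : ∀ {m n} → m % p ≡ n % p → ι m ≡ ι n
  ι-cong% {m} {n} e = toℕ-injective (trans (toℕ-ι m) (trans e (sym (toℕ-ι n))))

  add mul : Fin p → Fin p → Fin p
  add x y = ι (toℕ x ℕ.+ toℕ y)
  mul x y = ι (toℕ x ℕ.* toℕ y)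

  ι-+ : ∀ m n → add (ι m) (ι n) ≡ ι (m ℕ.+ n)
  ι-+ m n = ι-cong% (trans (cong₂ (λ a b → (a ℕ.+ b) % p) (toℕ-ι m) (toℕ-ι n))
                           (sym (%-distribˡ-+ m n p)))

  ι-* : ∀ m n → mul (ι m) (ι n) ≡ ι (m ℕ.* n)
  ι-* m n = ι-cong% (trans (cong₂ (λ a b → (a ℕ.* b) % p) (toℕ-ι m) (toℕ-ι n))
                           (sym (%-distribˡ-* m n p)))

  ι-+ˡ : ∀ m y → add (ι m) y ≡ ι (m ℕ.+ toℕ y)
  ι-+ˡ m y = trans (cong (add (ι m)) (sym (ι-toℕ y))) (ι-+ m (toℕ y))

  ι-+ʳ : ∀ x n → add x (ι n) ≡ ι (toℕ x ℕ.+ n)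
  ι-+ʳ x n = trans (cong (λ z → add z (ι n)) (sym (ι-toℕ x))) (ι-+ (toℕ x) n)

  ι-*ˡ : ∀ m y → mul (ι m) y ≡ ι (m ℕ.* toℕ y)
  ι-*ˡ m y = trans (cong (mul (ι m)) (sym (ι-toℕ y))) (ι-* m (toℕ y))

  ι-*ʳ : ∀ x n → mul x (ι n) ≡ ι (toℕ x ℕ.* n)
  ι-*ʳ x n = trans (cong (λ z → mul z (ι n)) (sym (ι-toℕ x))) (ι-* (toℕ x) n)

  opp : Fin p → Fin p
  opp x = ι (p ℕ.∸ toℕ x)

  opp-inverseʳ : ∀ x → add x (opp x) ≡ ι 0
  opp-inverseʳ x = trans (ι-+ʳ x (p ℕ.∸ toℕ x)) (ι-cong%
    (trans (cong (_% p) (ℕ.m+[n∸m]≡n (ℕ.<⇒≤ (toℕ<n x))))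
           (trans (n%n≡0 p) (sym (m<n⇒m%n≡m (ℕ.>-nonZero⁻¹ p))))))

  add-comm : ∀ x y → add x y ≡ add y x
  add-comm x y = cong ι (ℕ.+-comm (toℕ x) (toℕ y))

  add-assoc : ∀ x y z → add (add x y) z ≡ add x (add y z)
  add-assoc x y z = trans (ι-+ˡ (toℕ x ℕ.+ toℕ y) z)
    (trans (cong ι (ℕ.+-assoc (toℕ x) (toℕ y) (toℕ z))) (sym (ι-+ʳ x (toℕ y ℕ.+ toℕ z))))

  add-identityˡ : ∀ x → add (ι 0) x ≡ x
  add-identityˡ x = trans (ι-+ˡ 0 x) (ι-toℕ x)

  mul-comm : ∀ x y → mul x y ≡ mul y x
  mul-comm x y = cong ι (ℕ.*-comm (toℕ x) (toℕ y))

  mul-assoc : ∀ x y z → mul (mul x y) z ≡ mul x (mul y z)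
  mul-assoc x y z = trans (ι-*ˡ (toℕ x ℕ.* toℕ y) z)
    (trans (cong ι (ℕ.*-assoc (toℕ x) (toℕ y) (toℕ z))) (sym (ι-*ʳ x (toℕ y ℕ.* toℕ z))))

  mul-identityˡ : ∀ x → mul (ι 1) x ≡ x
  mul-identityˡ x = trans (ι-*ˡ 1 x) (trans (cong ι (ℕ.*-identityˡ (toℕ x))) (ι-toℕ x))

  mul-distribˡ : ∀ x y z → mul x (add y z) ≡ add (mul x y) (mul x z)
  mul-distribˡ x y z = trans (ι-*ʳ x (toℕ y ℕ.+ toℕ z))
    (trans (cong ι (ℕ.*-distribˡ-+ (toℕ x) (toℕ y) (toℕ z)))
           (sym (ι-+ (toℕ x ℕ.* toℕ y) (toℕ x ℕ.* toℕ z))))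

module _ (p : ℕ) .{{_ : NonZero p}} where

  open Residue p

  𝔽 : CommutativeRing 0ℓ 0ℓ
  𝔽 = record
    { Carrier = Fin p
    ; _≈_     = _≡_
    ; _+_     = λ x y → (toℕ x ℕ.+ toℕ y) mod p
    ; _*_     = λ x y → (toℕ x ℕ.* toℕ y) mod p
    ; -_      = λ x → (p ℕ.∸ toℕ x) mod p
    ; 0#      = 0 mod p
    ; 1#      = 1 mod p
    ; isCommutativeRing = record
      { isRing = record
        { +-isAbelianGroup = record
          { isGroup = record
            { isMonoid = record
              { isSemigroup = record
                { isMagma = record { isEquivalence = isEquivalence ; ∙-cong = cong₂ add }
                ; assoc   = add-assoc
                }
              ; identity = add-identityˡ , λ x → trans (add-comm x (ι 0)) (add-identityˡ x)
              }
            ; inverse = (λ x → trans (add-comm (opp x) x) (opp-inverseʳ x)) , opp-inverseʳ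
            ; ⁻¹-cong = cong opp
            }
          ; comm = add-comm
          }
        ; *-cong     = cong₂ mul
        ; *-assoc    = mul-assoc
        ; *-identity = mul-identityˡ , λ x → trans (mul-comm x (ι 1)) (mul-identityˡ x)
        ; distrib    = mul-distribˡ , λ x y z → trans (mul-comm (add y z) x)
            (trans (mul-distribˡ x y z) (cong₂ add (mul-comm x y) (mul-comm x z)))
        }
      ; *-comm = mul-comm
      }
    }

------------------------------------------------------------------------
-- The Markoff surface over 𝔽 p and the action of G

module _ (p : ℕ) .{{_ : NonZero p}} where

  open CommutativeRing (𝔽 p)
    using (_+_; _*_; _-_; -_; 0#; +-assoc; +-comm; *-comm; *-assoc; zeroˡ
          ; distribˡ; +-identityʳ; -‿inverseˡ; -‿inverseʳ)

  Triple : Set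
  Triple = Fin p × Fin p × Fin p

  IsMarkoff : Triple → Set
  IsMarkoff (x , y , z) =
    ¬ (x , y , z) ≡ (0# , 0# , 0#) × x * x + y * y + z * z ≡ x * y * z

  move : Generator → Triple → Triple
  move m₁ (x , y , z) = y * z - x , y , z
  move m₂ (x , y , z) = x , x * z - y , z
  move m₃ (x , y , z) = x , y , x * y - z

  -- The left action: the rightmost letter of the word moves first.
  act : Word → Triple → Triple
  act g t = foldr move t g

  _≟T_ : DecidableEquality Triple
  _≟T_ = ≡-dec Fin._≟_ (≡-dec Fin._≟_ Fin._≟_)

  IsMarkoff? : ∀ t → Dec (IsMarkoff t)
  IsMarkoff? t@(x , y , z) =
    ¬? (t ≟T (0# , 0# , 0#)) ×-dec (x * x + y * y + z * z Fin.≟ x * y * z)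

  triples : List Triple
  triples = cartesianProduct (allFin p) (cartesianProduct (allFin p) (allFin p))

  fixedPoints : Word → List Triple
  fixedPoints g = filter (λ t → IsMarkoff? t ×-dec (act g t ≟T t)) triples

  #fixedPoints : Word → ℕ
  #fixedPoints g = length (fixedPoints g)

  private
    open ≡-Reasoning

    +-cancelʳ : ∀ u v w → u + w ≡ v + w → u ≡ v
    +-cancelʳ u v w e = begin
      u             ≡⟨ undo u ⟨
      (u + w) - w   ≡⟨ cong (_- w) e ⟩
      (v + w) - w   ≡⟨ undo v ⟩
      v             ∎
      where
      undo : ∀ u → (u + w) - w ≡ u
      undo u = trans (+-assoc u w (- w)) (trans (cong (_+_ u) (-‿inverseʳ w)) (+-identityʳ u))

    sub-add : ∀ s x → (s - x) + x ≡ s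
    sub-add s x = trans (+-assoc s (- x) x) (trans (cong (_+_ s) (-‿inverseˡ x)) (+-identityʳ s))

    sub-sub : ∀ s x → s - (s - x) ≡ x
    sub-sub s x = +-cancelʳ (s - (s - x)) x (s - x)
      (trans (sub-add s (s - x)) (trans (sym (sub-add s x)) (+-comm (s - x) x)))

    -- Vieta: x and s - x are the two roots of X² + r = sX.
    vieta : ∀ s r x → x * x + r ≡ x * s → (s - x) * (s - x) + r ≡ (s - x) * s
    vieta s r x e = begin
      w * w + r       ≡⟨ cong (_+_ (w * w)) r≡ ⟩
      w * w + w * x   ≡⟨ distribˡ w w x ⟨
      w * (w + x)     ≡⟨ cong (_*_ w) (sub-add s x) ⟩
      w * s           ∎
      where
      w = s - x
      r≡ : r ≡ w * x
      r≡ = +-cancelʳ r (w * x) (x * x) (begin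
        r + x * x       ≡⟨ +-comm r (x * x) ⟩
        x * x + r       ≡⟨ e ⟩
        x * s           ≡⟨ cong (_*_ x) (sub-add s x) ⟨
        x * (w + x)     ≡⟨ distribˡ x w x ⟩
        x * w + x * x   ≡⟨ cong (λ u → u + x * x) (*-comm x w) ⟩
        w * x + x * x   ∎)

    sum₂ : ∀ a b c → a + b + c ≡ b + (a + c)
    sum₂ a b c = trans (cong (λ u → u + c) (+-comm a b)) (+-assoc b a c)

    prod₂ : ∀ x y z → x * y * z ≡ y * (x * z)
    prod₂ x y z = trans (cong (λ u → u * z) (*-comm x y)) (*-assoc y x z)

    sum₃ : ∀ a b c → a + b + c ≡ c + (a + b)
    sum₃ a b c = +-comm (a + b) c

    0*0-0 : 0# * 0# - 0# ≡ 0#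
    0*0-0 = trans (cong (_- 0#) (zeroˡ 0#)) (-‿inverseʳ 0#)

    move-0 : ∀ i → move i (0# , 0# , 0#) ≡ (0# , 0# , 0#)
    move-0 m₁ = cong (λ u → u , 0# , 0#) 0*0-0
    move-0 m₂ = cong (λ u → 0# , u , 0#) 0*0-0
    move-0 m₃ = cong (λ u → 0# , 0# , u) 0*0-0

  move-involutive : ∀ i t → move i (move i t) ≡ t
  move-involutive m₁ (x , y , z) = cong (λ u → u , y , z) (sub-sub (y * z) x)
  move-involutive m₂ (x , y , z) = cong (λ u → x , u , z) (sub-sub (x * z) y)
  move-involutive m₃ (x , y , z) = cong (λ u → x , y , u) (sub-sub (x * y) z)

  move-isMarkoff : ∀ i {t} → IsMarkoff t → IsMarkoff (move i t)
  move-isMarkoff i {t} (t≢0 , e) = nonzero , equation i t e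
    where
    nonzero : ¬ move i t ≡ (0# , 0# , 0#)
    nonzero mt≡0 = t≢0 (begin
      t                       ≡⟨ move-involutive i t ⟨
      move i (move i t)       ≡⟨ cong (move i) mt≡0 ⟩
      move i (0# , 0# , 0#)   ≡⟨ move-0 i ⟩
      (0# , 0# , 0#)          ∎)

    Eqn : Triple → Set
    Eqn (x , y , z) = x * x + y * y + z * z ≡ x * y * z

    equation : ∀ i t → Eqn t → Eqn (move i t)
    equation m₁ (x , y , z) e =
      trans (+-assoc (x′ * x′) (y * y) (z * z)) (trans
        (vieta (y * z) (y * y + z * z) x
          (trans (sym (+-assoc (x * x) (y * y) (z * z))) (trans e (*-assoc x y z))))
        (sym (*-assoc x′ y z)))
      where x′ = y * z - x
    equation m₂ (x , y , z) e =
      trans (sum₂ (x * x) (y′ * y′) (z * z)) (trans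
        (vieta (x * z) (x * x + z * z) y
          (trans (sym (sum₂ (x * x) (y * y) (z * z))) (trans e (prod₂ x y z))))
        (sym (prod₂ x y′ z)))
      where y′ = x * z - y
    equation m₃ (x , y , z) e =
      trans (sum₃ (x * x) (y * y) (z′ * z′)) (trans
        (vieta (x * y) (x * x + y * y) z
          (trans (sym (sum₃ (x * x) (y * y) (z * z))) (trans e (*-comm (x * y) z))))
        (*-comm z′ (x * y)))
      where z′ = x * y - z

  act-isMarkoff : ∀ g {t} → IsMarkoff t → IsMarkoff (act g t)
  act-isMarkoff []      h = h
  act-isMarkoff (i ∷ g) h = move-isMarkoff i (act-isMarkoff g h)

  act-cong : ∀ {g h} → g ≈G h → ∀ t → act g t ≡ act h t
  act-cong g≈h t = EqC.gfold isEquivalence (λ g → act g t) cancels g≈h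
    where
    cancels : ∀ {u v} → Cancels u v → act u t ≡ act v t
    cancels (cancel []      i v) = move-involutive i (act v t)
    cancels (cancel (j ∷ u) i v) = cong (move j) (cancels (cancel u i v))

{-# OPTIONS --safe #-}

-- A Markoff triple with xyz ≠ 0 is determined by u = x/z and v = y/z, and its coordinates are
-- Laurent polynomials in v for fixed u. As v → ∞ they have poles of orders (1 , 2 , 1), with
-- nonzero leading coefficients. If w is a reduced word whose first move is not m₂, then
-- each move replaces a pole order by the sum of the other two, which is larger, and the new
-- leading coefficient is the product of the other two. Hence the last moved coordinate of w(P)
-- minus that of P has a pole of order exactly d at infinity and at most d at 0, where d > 0, so
-- for each u at most 2d values of v give a point fixed by w. If the first move is m₂, exchange the roles of u and v.
-- The pole orders are |t|, |s| and |s - t| for the vector (s , t) = ρ(w)(2 , 1), respectively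
-- ρ(w)(1 , 2), so d ≤ 6N. At most 6p triples have xyz = 0, and the total is at most
-- 12pN + 6p.

module Submission where

open import Defs
open import Algebra.Bundles using (CommutativeRing; module Group)
import Algebra.Properties.CommutativeSemigroup as SemigroupProperties
import Algebra.Properties.Ring as RingProperties
import Algebra.Properties.Semiring.Exp as Exp
import Algebra.Solver.Ring.NaturalCoefficients.Default as SemiringSolver
open import Data.Fin.Base using (Fin; toℕ)
import Data.Fin.Properties as Fin
open import Data.Integer.Base as ℤ using (ℤ; +_; 0ℤ; 1ℤ; -1ℤ)
import Data.Integer.Properties as ℤ
import Data.Integer.Tactic.RingSolver as ℤ-Solver
open import Data.List.Base using ([]; _∷_; foldr; filter; map; length; allFin)
open import Data.List.Membership.Propositional using (_∈_)
open import Data.List.Membership.Propositional.Properties using (∈-allFin)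
open import Data.List.Properties using (length-map; length-tabulate)
open import Data.List.Relation.Unary.All as All using (All; []; _∷_)
import Data.List.Relation.Unary.All.Properties as All
open import Data.List.Relation.Unary.AllPairs using (AllPairs; []; _∷_)
open import Data.List.Relation.Unary.Any using (here; there)
open import Data.List.Relation.Unary.Linked as Linked using (Linked; []; [-]; _∷_)
open import Data.List.Relation.Unary.Unique.Propositional using (Unique)
import Data.List.Relation.Unary.Unique.Propositional.Properties as Unique
open import Data.Nat.Base as ℕ using (ℕ; zero; suc; z≤n; s≤s; _≤_; _<_; _⊔_; NonZero)
open import Data.Nat.Coprimality using (coprime-Bézout; prime⇒coprime)
open import Data.Nat.Divisibility using (_∣_)
open import Data.Nat.DivMod using ([m+kn]%n≡m%n; m*n%n≡0; m<n⇒m%n≡m)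
open import Data.Nat.GCD using (module Bézout)
open import Data.Nat.Primality using (Prime; prime⇒nonZero; prime⇒nonTrivial)
import Data.Nat.Properties as ℕ
import Data.Nat.Tactic.RingSolver as ℕ-Solver
open import Data.Product.Base using (_×_; _,_; ∃-syntax; proj₁; proj₂)
open import Data.Sum.Base as Sum using (_⊎_; inj₁; inj₂; [_,_]′)
open import Function.Base using (_∘_; id)
import Level
import Relation.Binary.Construct.Closure.Equivalence as EqC
open import Relation.Binary.Definitions using (DecidableEquality)
open import Relation.Binary.PropositionalEquality as ≡ using (_≡_; _≢_; module ≡-Reasoning)
open import Relation.Binary.Structures using (IsEquivalence)
open import Relation.Nullary using (¬_; contradiction; yes; no; ¬?)
open import Relation.Nullary.Decidable using (_×-dec_)
open import Relation.Unary using (Decidable)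

-- Polynomial functions

module PolynomialFunctions {r ℓ} (R : CommutativeRing r ℓ) where

  open CommutativeRing R
  open Exp semiring using (_^_)
  open SemiringSolver commutativeSemiring
  open import Relation.Binary.Reasoning.Setoid setoid

  -- Poly n f a: f is a polynomial function of formal degree n, given by its Horner
  -- scheme, in which the coefficient of xⁿ is a (possibly zero).
  data Poly : ℕ → (Carrier → Carrier) → Carrier → Set (r Level.⊔ ℓ) where
    const : ∀ {f a} → (∀ x → f x ≈ a) → Poly 0 f a
    step  : ∀ {n f g a} b → (∀ x → f x ≈ b + x * g x) → Poly n g a → Poly (suc n) f a

  Poly-resp : ∀ {n f g a b} → (∀ x → f x ≈ g x) → a ≈ b → Poly n f a → Poly n g b
  Poly-resp f≈g a≈b (const e)    = const λ x → trans (sym (f≈g x)) (trans (e x) a≈b)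
  Poly-resp f≈g a≈b (step c e p) =
    step c (λ x → trans (sym (f≈g x)) (e x)) (Poly-resp (λ _ → refl) a≈b p)

  Poly-suc : ∀ {n f a} → Poly n f a → Poly (suc n) f 0#
  Poly-suc {a = a} (const e) = step a
    (λ x → trans (e x) (solve 2 (λ a x → a := a :+ x :* con 0) refl a x))
    (const λ _ → refl)
  Poly-suc (step b e p) = step b e (Poly-suc p)

  Poly-< : ∀ {m n f a} → m < n → Poly m f a → Poly n f 0#
  Poly-< m<n p = raise (ℕ.≤⇒≤′ m<n) p
    where
    raise : ∀ {m n f a} → suc m ℕ.≤′ n → Poly m f a → Poly n f 0#
    raise ℕ.≤′-refl       p = Poly-suc p
    raise (ℕ.≤′-step m<n) p = Poly-suc (raise m<n p)

  Poly-+ : ∀ {n f g a b} → Poly n f a → Poly n g b → Poly n (λ x → f x + g x) (a + b)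
  Poly-+ (const e) (const e′) = const λ x → +-cong (e x) (e′ x)
  Poly-+ (step {g = f₁} b e p) (step {g = g₁} b′ e′ p′) = step (b + b′)
    (λ x → trans (+-cong (e x) (e′ x))
      (solve 5 (λ b b′ x u v → (b :+ x :* u) :+ (b′ :+ x :* v)
                               := (b :+ b′) :+ x :* (u :+ v))
               refl b b′ x (f₁ x) (g₁ x)))
    (Poly-+ p p′)

  Poly-scale : ∀ {n f a} c → Poly n f a → Poly n (λ x → c * f x) (c * a)
  Poly-scale c (const e) = const λ x → *-congˡ (e x)
  Poly-scale c (step {g = f₁} b e p) = step (c * b)
    (λ x → trans (*-congˡ (e x))
      (solve 4 (λ c b x u → c :* (b :+ x :* u) := c :* b :+ x :* (c :* u)) refl c b x (f₁ x)))
    (Poly-scale c p)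

  -- Since (c + x f₁) g = c g + x (f₁ g), the summand c g has smaller formal degree; padded with
  -- zeros, it leaves the leading coefficient alone.
  Poly-* : ∀ {m n f g a b} → Poly m f a → Poly n g b → Poly (m ℕ.+ n) (λ x → f x * g x) (a * b)
  Poly-* {a = a} (const e) q = Poly-resp (λ x → *-congʳ (sym (e x))) refl (Poly-scale a q)
  Poly-* {suc m} {n} {g = g} (step {g = f₁} c e p) q = Poly-resp
    (λ x → trans
      (solve 4 (λ c x u v → c :* v :+ (con 0 :+ x :* (u :* v)) := (c :+ x :* u) :* v)
               refl c x (f₁ x) (g x))
      (*-congʳ (sym (e x))))
    (+-identityˡ _)
    (Poly-+ (Poly-< (s≤s (ℕ.m≤n+m n m)) (Poly-scale c q))
            (step 0# (λ _ → refl) (Poly-* p q)))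

  Poly-^ : ∀ n → Poly n (_^ n) 1#
  Poly-^ zero    = const λ _ → refl
  Poly-^ (suc n) = step 0# (λ x → sym (+-identityˡ _)) (Poly-^ n)

  Poly-quadratic : ∀ k → Poly 2 (λ x → x * x + k) 1#
  Poly-quadratic k = step k (λ x → +-comm (x * x) k)
    (step 0# (λ x → trans (sym (*-identityʳ x)) (sym (+-identityˡ _))) (const λ _ → refl))

  -- f(x) - f(r) = (x - r) g(x), with both sides moved so that no subtraction occurs.
  Poly-factor : ∀ {n f a} → Poly (suc n) f a → ∀ r →
    ∃[ g ] Poly n g a × (∀ x → f x + r * g x ≈ f r + x * g x)
  Poly-factor {f = f} {a = a} (step {g = f₁} b e (const e₁)) r =
    (λ _ → a) , const (λ _ → refl) , λ x → begin
    f x + r * a               ≈⟨ +-congʳ (trans (e x) (+-congˡ (*-congˡ (e₁ x)))) ⟩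
    (b + x * a) + r * a       ≈⟨ solve 4 (λ b x a r → (b :+ x :* a) :+ r :* a
                                            := (b :+ r :* a) :+ x :* a) refl b x a r ⟩
    (b + r * a) + x * a       ≈⟨ +-congʳ (trans (e r) (+-congˡ (*-congˡ (e₁ r)))) ⟨
    f r + x * a               ∎
  Poly-factor {suc n} {f} {a} (step {g = f₁} b e p@(step _ _ _)) r with Poly-factor p r
  ... | g₁ , q , e₁ = g
    , Poly-resp (λ _ → refl) (+-identityʳ a) (Poly-+ p (Poly-suc (Poly-scale r q)))
    , λ x → begin
    f x + r * g x
      ≈⟨ +-congʳ (e x) ⟩
    (b + x * f₁ x) + r * (f₁ x + r * g₁ x)
      ≈⟨ +-congˡ (*-congˡ (e₁ x)) ⟩
    (b + x * f₁ x) + r * (f₁ r + x * g₁ x)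
      ≈⟨ solve 6 (λ b x r u w v → (b :+ x :* u) :+ r :* (w :+ x :* v)
                    := (b :+ r :* w) :+ x :* (u :+ r :* v)) refl b x r (f₁ x) (f₁ r) (g₁ x) ⟩
    (b + r * f₁ r) + x * g x
      ≈⟨ +-congʳ (e r) ⟨
    f r + x * g x ∎
    where
    -- Synthetic division: f(x) - f(r) = x f₁(x) - r f₁(r) = (x - r) f₁(x) + r (f₁(x) - f₁(r)).
    g : Carrier → Carrier
    g x = f₁ x + r * g₁ x

-- Laurent polynomials and their poles over an integral domain

Nontrivial : ∀ {r ℓ} → CommutativeRing r ℓ → Set ℓ
Nontrivial R = ¬ 1# ≈ 0#
  where open CommutativeRing R

NoZeroDivisors : ∀ {r ℓ} → CommutativeRing r ℓ → Set (r Level.⊔ ℓ)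
NoZeroDivisors R = ∀ {x y} → x * y ≈ 0# → x ≈ 0# ⊎ y ≈ 0#
  where open CommutativeRing R

module Poles {r ℓ} (R : CommutativeRing r ℓ)
  (nontrivial : Nontrivial R) (integral : NoZeroDivisors R) where

  open CommutativeRing R
  open PolynomialFunctions R
  open RingProperties ring
    using (x≈y⇒x∙y⁻¹≈ε; x∙y⁻¹≈ε⇒x≈y; [y-z]x≈yx-zx; -1*x≈-x; -0#≈0#; -‿involutive)
  open Exp semiring using (_^_; ^-homo-*; ^-congʳ)
  open SemigroupProperties ℕ.+-commutativeSemigroup using (interchange)
  open SemiringSolver commutativeSemiring
  open import Relation.Binary.Reasoning.Setoid setoid

  *-≉0 : ∀ {x y} → ¬ x ≈ 0# → ¬ y ≈ 0# → ¬ x * y ≈ 0#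
  *-≉0 x≉0 y≉0 = [ x≉0 , y≉0 ]′ ∘ integral

  *-cancelʳ-≉ : ∀ {x y z} → ¬ x ≈ y → x * z ≈ y * z → z ≈ 0#
  *-cancelʳ-≉ {x} {y} {z} x≉y e
    with integral {x - y} {z} (trans ([y-z]x≈yx-zx z x y) (x≈y⇒x∙y⁻¹≈ε e))
  ... | inj₁ x-y≈0 = contradiction (x∙y⁻¹≈ε⇒x≈y x y x-y≈0) x≉y
  ... | inj₂ z≈0   = z≈0

  -- Dividing out one root r keeps the leading coefficient, and the quotient vanishes at the
  -- remaining roots because x - r can be cancelled there.
  Poly-roots : ∀ {n f a xs} → Poly n f a → ¬ a ≈ 0# →
    AllPairs (λ x y → ¬ x ≈ y) xs → All (λ x → f x ≈ 0#) xs → length xs ≤ n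
  Poly-roots p a≉0 [] [] = z≤n
  Poly-roots (const e) a≉0 (_ ∷ _) (fx≈0 ∷ _) = contradiction (trans (sym (e _)) fx≈0) a≉0
  Poly-roots {f = f} {xs = r ∷ xs} p@(step _ _ _) a≉0 (r≉xs ∷ xs!) (fr≈0 ∷ fxs≈0)
    with Poly-factor p r
  ... | g , q , e = s≤s (Poly-roots q a≉0 xs! (All.zipWith gx≈0 (r≉xs , fxs≈0)))
    where
    gx≈0 : ∀ {x} → ¬ r ≈ x × f x ≈ 0# → g x ≈ 0#
    gx≈0 {x} (r≉x , fx≈0) = *-cancelʳ-≉ r≉x (begin
      r * g x         ≈⟨ +-identityˡ _ ⟨
      0# + r * g x    ≈⟨ +-congʳ fx≈0 ⟨
      f x + r * g x   ≈⟨ e x ⟩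
      f r + x * g x   ≈⟨ +-congʳ fr≈0 ⟩
      0# + x * g x    ≈⟨ +-identityˡ _ ⟩
      x * g x         ∎)

  -- On x ≠ 0, f is a Laurent polynomial with a pole of order exactly d at infinity and
  -- of order at most d at 0.
  record HasPole (d : ℕ) (f : Carrier → Carrier) : Set (r Level.⊔ ℓ) where
    field
      {numerator} : Carrier → Carrier
      {leading}   : Carrier
      leading≉0   : ¬ leading ≈ 0#
      isPoly      : Poly (d ℕ.+ d) numerator leading
      clears      : ∀ {x} → ¬ x ≈ 0# → f x * x ^ d ≈ numerator x

  HasPole-const : ∀ {a} → ¬ a ≈ 0# → HasPole 0 (λ _ → a)
  HasPole-const a≉0 = record
    { leading≉0 = a≉0
    ; isPoly    = const λ _ → refl
    ; clears    = λ _ → *-identityʳ _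
    }

  -- The function is x + k/x away from 0; k = 0 gives the identity, and other values of k give
  -- `abscissa`.
  HasPole-quadratic : ∀ {f} k → (∀ {x} → ¬ x ≈ 0# → f x * x ≈ x * x + k) → HasPole 1 f
  HasPole-quadratic k e = record
    { leading≉0 = nontrivial
    ; isPoly    = Poly-quadratic k
    ; clears    = λ x≉0 → trans (*-congˡ (*-identityʳ _)) (e x≉0)
    }

  HasPole-x : HasPole 1 (λ x → x)
  HasPole-x = HasPole-quadratic 0# λ _ → sym (+-identityʳ _)

  HasPole-* : ∀ {d e f g} → HasPole d f → HasPole e g → HasPole (d ℕ.+ e) (λ x → f x * g x)
  HasPole-* {d} {e} {f} {g} F G = record
    { leading≉0 = *-≉0 F.leading≉0 G.leading≉0
    ; isPoly    = ≡.subst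
        (λ n → Poly n (λ x → F.numerator x * G.numerator x) (F.leading * G.leading))
        (interchange d d e e) (Poly-* F.isPoly G.isPoly)
    ; clears    = λ {x} x≉0 → begin
        f x * g x * x ^ (d ℕ.+ e)         ≈⟨ *-congˡ (^-homo-* x d e) ⟩
        f x * g x * (x ^ d * x ^ e)       ≈⟨ solve 4 (λ u v s t → u :* v :* (s :* t)
                                                                := (u :* s) :* (v :* t))
                                                     refl (f x) (g x) (x ^ d) (x ^ e) ⟩
        (f x * x ^ d) * (g x * x ^ e)     ≈⟨ *-cong (F.clears x≉0) (G.clears x≉0) ⟩
        F.numerator x * G.numerator x     ∎
    }
    where
    module F = HasPole F
    module G = HasPole G

  -- Over the common denominator x ^ d, the numerator of g gets formal degree 2e + (d - e) = d + e <
  -- 2d. The strict inequality e < d thus rules out cancellation with the leading term of f.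
  HasPole-+ : ∀ {d e f g} → e < d → HasPole d f → HasPole e g → HasPole d (λ x → f x + g x)
  HasPole-+ {d} {e} {f} {g} e<d F G = record
    { leading≉0 = λ l≈0 → F.leading≉0 (trans (sym (+-identityʳ _)) l≈0)
    ; isPoly    = Poly-+ F.isPoly (Poly-< degree (Poly-* G.isPoly (Poly-^ (d ℕ.∸ e))))
    ; clears    = λ {x} x≉0 → trans (distribʳ _ _ _) (+-cong (F.clears x≉0) (begin
        g x * x ^ d                       ≈⟨ *-congˡ (^-congʳ x (≡.sym e+k≡d)) ⟩
        g x * x ^ (e ℕ.+ (d ℕ.∸ e))       ≈⟨ *-congˡ (^-homo-* x e (d ℕ.∸ e)) ⟩
        g x * (x ^ e * x ^ (d ℕ.∸ e))     ≈⟨ *-assoc _ _ _ ⟨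
        g x * x ^ e * x ^ (d ℕ.∸ e)       ≈⟨ *-congʳ (G.clears x≉0) ⟩
        G.numerator x * x ^ (d ℕ.∸ e)     ∎))
    }
    where
    module F = HasPole F
    module G = HasPole G
    e+k≡d : e ℕ.+ (d ℕ.∸ e) ≡ d
    e+k≡d = ℕ.m+[n∸m]≡n (ℕ.<⇒≤ e<d)
    degree : e ℕ.+ e ℕ.+ (d ℕ.∸ e) < d ℕ.+ d
    degree = ≡.subst (_< d ℕ.+ d)
      (≡.trans (≡.cong (e ℕ.+_) (≡.sym e+k≡d)) (≡.sym (ℕ.+-assoc e e (d ℕ.∸ e))))
      (ℕ.+-monoˡ-< d e<d)

  HasPole-minus : ∀ {d e f g} → e < d → HasPole d f → HasPole e g → HasPole d (λ x → f x - g x)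
  HasPole-minus {d} {f = f} {g = g} e<d F G = record
    { leading≉0 = H.leading≉0
    ; isPoly    = H.isPoly
    ; clears    = λ x≉0 → trans (*-congʳ (+-congˡ (sym (-1*x≈-x _)))) (H.clears x≉0)
    }
    where
    -1≉0 : ¬ - 1# ≈ 0#
    -1≉0 e = nontrivial (trans (sym (-‿involutive 1#)) (trans (-‿cong e) -0#≈0#))
    module H = HasPole (HasPole-+ e<d F (HasPole-* (HasPole-const -1≉0) G))

  HasPole-roots : ∀ {d f xs} → HasPole d f → AllPairs (λ x y → ¬ x ≈ y) xs →
    All (λ x → ¬ x ≈ 0# × f x ≈ 0#) xs → length xs ≤ d ℕ.+ d
  HasPole-roots {d} F xs! roots = Poly-roots F.isPoly F.leading≉0 xs!
    (All.map (λ (x≉0 , fx≈0) → trans (sym (F.clears x≉0)) (trans (*-congʳ fx≈0) (zeroˡ _))) roots)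
    where module F = HasPole F

-- Reduced words and the growth of degrees

open ≡ using (refl; sym; trans; cong; cong₂; subst)

infix 4 _≟G_

_≟G_ : DecidableEquality Generator
m₁ ≟G m₁ = yes refl
m₁ ≟G m₂ = no λ ()
m₁ ≟G m₃ = no λ ()
m₂ ≟G m₁ = no λ ()
m₂ ≟G m₂ = yes refl
m₂ ≟G m₃ = no λ ()
m₃ ≟G m₁ = no λ ()
m₃ ≟G m₂ = no λ ()
m₃ ≟G m₃ = yes refl

private
  module ≈G = IsEquivalence (EqC.isEquivalence Cancels)
  module ≈P = IsEquivalence ≈P-isEquivalence

reduced-form : ∀ g → ∃[ w ] Linked _≢_ w × g ≈G w
reduced-form [] = [] , [] , ≈G.refl
reduced-form (i ∷ g) with reduced-form g
... | w , w-reduced , g≈w = cons w w-reduced (++-congˡ (i ∷ []) g≈w)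
  where
  cons : ∀ w → Linked _≢_ w → i ∷ g ≈G i ∷ w → ∃[ w′ ] Linked _≢_ w′ × i ∷ g ≈G w′
  cons []      _ e = i ∷ [] , [-] , e
  cons (k ∷ w) r e with i ≟G k
  ... | yes refl = w , Linked.tail r , ≈G.trans e (EqC.return (cancel [] i w))
  ... | no i≢k   = i ∷ k ∷ w , i≢k ∷ r , e

-- Path j i w: the word w can follow the letter j in a reduced word, and i is the last
-- letter to act in the resulting word (the head of w, or j if w is empty).
data Path (j : Generator) : Generator → Word → Set where
  []  : Path j j []
  _∷_ : ∀ {i k w} → i ≢ k → Path j k w → Path j i (i ∷ w)

-- The letter that acts first cannot equal both m₁ and m₂, so at least one of them can precede it in
-- a reduced word.
reduced⇒path : ∀ {i w} → Linked _≢_ (i ∷ w) → Path m₁ i (i ∷ w) ⊎ Path m₂ i (i ∷ w)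
reduced⇒path {m₁} [-] = inj₂ ((λ ()) ∷ [])
reduced⇒path {m₂} [-] = inj₁ ((λ ()) ∷ [])
reduced⇒path {m₃} [-] = inj₁ ((λ ()) ∷ [])
reduced⇒path (i≢k ∷ r) = Sum.map (i≢k ∷_) (i≢k ∷_) (reduced⇒path r)

coord : ∀ {a} {A : Set a} → Generator → A × A × A → A
coord m₁ (x , y , z) = x
coord m₂ (x , y , z) = y
coord m₃ (x , y , z) = z

-- Pole orders under the moves, and the vectors that encode them

-- The pole order of a product minus the old coordinate, in the case where the product dominates.
tropicalMove : Generator → ℕ × ℕ × ℕ → ℕ × ℕ × ℕ
tropicalMove m₁ (a , b , c) = b ℕ.+ c , b , c
tropicalMove m₂ (a , b , c) = a , a ℕ.+ c , c
tropicalMove m₃ (a , b , c) = a , b , a ℕ.+ b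

degrees : ℕ × ℕ × ℕ → Word → ℕ × ℕ × ℕ
degrees = foldr tropicalMove

infixl 7 _·ᵥ_

_·ᵥ_ : Matrix → ℤ × ℤ → ℤ × ℤ
mat a b c d ·ᵥ (s , t) = a ℤ.* s ℤ.+ b ℤ.* t , c ℤ.* s ℤ.+ d ℤ.* t

·ᵥ-· : ∀ A B v → (A · B) ·ᵥ v ≡ A ·ᵥ (B ·ᵥ v)
·ᵥ-· (mat a b c d) (mat a′ b′ c′ d′) (s , t) =
  cong₂ _,_ (lem a b a′ b′ c′ d′ s t) (lem c d a′ b′ c′ d′ s t)
  where
  lem : ∀ a b a′ b′ c′ d′ s t →
        (a ℤ.* a′ ℤ.+ b ℤ.* c′) ℤ.* s ℤ.+ (a ℤ.* b′ ℤ.+ b ℤ.* d′) ℤ.* t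
        ≡ a ℤ.* (a′ ℤ.* s ℤ.+ b′ ℤ.* t) ℤ.+ b ℤ.* (c′ ℤ.* s ℤ.+ d′ ℤ.* t)
  lem = ℤ-Solver.solve-∀

·ᵥ-identity : ∀ v → 1M ·ᵥ v ≡ v
·ᵥ-identity (s , t) = cong₂ _,_ (l s t) (r s t)
  where
  l : ∀ x y → 1ℤ ℤ.* x ℤ.+ 0ℤ ℤ.* y ≡ x
  l = ℤ-Solver.solve-∀
  r : ∀ x y → 0ℤ ℤ.* x ℤ.+ 1ℤ ℤ.* y ≡ y
  r = ℤ-Solver.solve-∀

-- The degrees (a , b , c) are (|t| , |s| , |s - t|); the generator in the index is the
-- coordinate whose degree is the sum of the other two, which fixes the signs up to ε.
data Slope : Generator → ℕ × ℕ × ℕ → ℤ × ℤ → Set where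
  slope₁ : ∀ ε b c → ℤ.∣ ε ∣ ≡ 1 →
           Slope m₁ (b ℕ.+ c , b , c) (ε ℤ.* + b , ε ℤ.* (+ b ℤ.+ + c))
  slope₂ : ∀ ε a c → ℤ.∣ ε ∣ ≡ 1 →
           Slope m₂ (a , a ℕ.+ c , c) (ε ℤ.* (+ a ℤ.+ + c) , ε ℤ.* + a)
  slope₃ : ∀ ε a b → ℤ.∣ ε ∣ ≡ 1 →
           Slope m₃ (a , b , a ℕ.+ b) (ε ℤ.* + b , ε ℤ.* ℤ.- + a)

-- Each generator matrix preserves two of |t|, |s| and |s - t| and turns the third into |2s - t|,
-- |2t - s| or |s + t|. The signs recorded at j ≠ i make this the sum of the two preserved values,
-- for example |2s - t| = |s| + |s - t|.
Slope-move : ∀ {i j D v} → i ≢ j → Slope j D v →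
             Slope i (tropicalMove i D) (matrix (generatorMatrix i) ·ᵥ v)
Slope-move {m₁} i≢j (slope₁ _ _ _ _) = contradiction refl i≢j
Slope-move {m₂} i≢j (slope₂ _ _ _ _) = contradiction refl i≢j
Slope-move {m₃} i≢j (slope₃ _ _ _ _) = contradiction refl i≢j
Slope-move {m₂} i≢j (slope₁ ε b c u) =
  subst (Slope m₂ _) (cong₂ _,_ (p ε (+ b) (+ c)) (q ε (+ b) (+ c))) (slope₂ ε (b ℕ.+ c) c u)
  where
  p : ∀ ε b c → ε ℤ.* ((b ℤ.+ c) ℤ.+ c) ≡ -1ℤ ℤ.* (ε ℤ.* b) ℤ.+ + 2 ℤ.* (ε ℤ.* (b ℤ.+ c))
  p = ℤ-Solver.solve-∀
  q : ∀ ε b c → ε ℤ.* (b ℤ.+ c) ≡ 0ℤ ℤ.* (ε ℤ.* b) ℤ.+ 1ℤ ℤ.* (ε ℤ.* (b ℤ.+ c))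
  q = ℤ-Solver.solve-∀
Slope-move {m₃} i≢j (slope₁ ε b c u) =
  subst (Slope m₃ _) (cong₂ _,_ (p ε (+ b) (+ c)) (q ε (+ b) (+ c)))
    -- The matrix of m₃ negates s and keeps t, which flips ε.
    (slope₃ (ℤ.- ε) (b ℕ.+ c) b (trans (ℤ.∣-i∣≡∣i∣ ε) u))
  where
  p : ∀ ε b c → ℤ.- ε ℤ.* b ≡ -1ℤ ℤ.* (ε ℤ.* b) ℤ.+ 0ℤ ℤ.* (ε ℤ.* (b ℤ.+ c))
  p = ℤ-Solver.solve-∀
  q : ∀ ε b c → ℤ.- ε ℤ.* ℤ.- (b ℤ.+ c) ≡ 0ℤ ℤ.* (ε ℤ.* b) ℤ.+ 1ℤ ℤ.* (ε ℤ.* (b ℤ.+ c))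
  q = ℤ-Solver.solve-∀
Slope-move {m₁} i≢j (slope₂ ε a c u) =
  subst (Slope m₁ _) (cong₂ _,_ (p ε (+ a) (+ c)) (q ε (+ a) (+ c))) (slope₁ ε (a ℕ.+ c) c u)
  where
  p : ∀ ε a c → ε ℤ.* (a ℤ.+ c) ≡ 1ℤ ℤ.* (ε ℤ.* (a ℤ.+ c)) ℤ.+ 0ℤ ℤ.* (ε ℤ.* a)
  p = ℤ-Solver.solve-∀
  q : ∀ ε a c → ε ℤ.* ((a ℤ.+ c) ℤ.+ c) ≡ + 2 ℤ.* (ε ℤ.* (a ℤ.+ c)) ℤ.+ -1ℤ ℤ.* (ε ℤ.* a)
  q = ℤ-Solver.solve-∀
Slope-move {m₃} i≢j (slope₂ ε a c u) =
  subst (Slope m₃ _) (cong₂ _,_ (p ε (+ a) (+ c)) (q ε (+ a) (+ c)))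
    (slope₃ (ℤ.- ε) a (a ℕ.+ c) (trans (ℤ.∣-i∣≡∣i∣ ε) u))
  where
  p : ∀ ε a c → ℤ.- ε ℤ.* (a ℤ.+ c) ≡ -1ℤ ℤ.* (ε ℤ.* (a ℤ.+ c)) ℤ.+ 0ℤ ℤ.* (ε ℤ.* a)
  p = ℤ-Solver.solve-∀
  q : ∀ ε a c → ℤ.- ε ℤ.* ℤ.- a ≡ 0ℤ ℤ.* (ε ℤ.* (a ℤ.+ c)) ℤ.+ 1ℤ ℤ.* (ε ℤ.* a)
  q = ℤ-Solver.solve-∀
Slope-move {m₁} i≢j (slope₃ ε a b u) =
  subst (Slope m₁ _) (cong₂ _,_ (p ε (+ a) (+ b)) (q ε (+ a) (+ b))) (slope₁ ε b (a ℕ.+ b) u)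
  where
  p : ∀ ε a b → ε ℤ.* b ≡ 1ℤ ℤ.* (ε ℤ.* b) ℤ.+ 0ℤ ℤ.* (ε ℤ.* ℤ.- a)
  p = ℤ-Solver.solve-∀
  q : ∀ ε a b → ε ℤ.* (b ℤ.+ (a ℤ.+ b)) ≡ + 2 ℤ.* (ε ℤ.* b) ℤ.+ -1ℤ ℤ.* (ε ℤ.* ℤ.- a)
  q = ℤ-Solver.solve-∀
Slope-move {m₂} i≢j (slope₃ ε a b u) =
  subst (Slope m₂ _) (cong₂ _,_ (p ε (+ a) (+ b)) (q ε (+ a) (+ b)))
    (slope₂ (ℤ.- ε) a (a ℕ.+ b) (trans (ℤ.∣-i∣≡∣i∣ ε) u))
  where
  p : ∀ ε a b → ℤ.- ε ℤ.* (a ℤ.+ (a ℤ.+ b)) ≡ -1ℤ ℤ.* (ε ℤ.* b) ℤ.+ + 2 ℤ.* (ε ℤ.* ℤ.- a)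
  p = ℤ-Solver.solve-∀
  q : ∀ ε a b → ℤ.- ε ℤ.* a ≡ 0ℤ ℤ.* (ε ℤ.* b) ℤ.+ 1ℤ ℤ.* (ε ℤ.* ℤ.- a)
  q = ℤ-Solver.solve-∀

Slope-path : ∀ {i j D v w} → Slope j D v → Path j i w →
             Slope i (degrees D w) (matrix (ρ w) ·ᵥ v)
Slope-path s []          = subst (Slope _ _) (sym (·ᵥ-identity _)) s
Slope-path {w = i ∷ w} s (i≢k ∷ P) = subst (Slope _ _)
  (sym (·ᵥ-· (matrix (generatorMatrix i)) (matrix (ρ w)) _)) (Slope-move i≢k (Slope-path s P))

unit-abs : ∀ ε n → ℤ.∣ ε ∣ ≡ 1 → n ≡ ℤ.∣ ε ℤ.* + n ∣
unit-abs ε n u = sym (trans (ℤ.abs-* ε (+ n)) (trans (cong (ℕ._* n) u) (ℕ.*-identityˡ n)))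

-- The coordinate is |t|, |s| or |s - t|, and the last is covered by the triangle inequality.
Slope-bound : ∀ {i D s t} → Slope i D (s , t) → coord i D ≤ ℤ.∣ s ∣ ℕ.+ ℤ.∣ t ∣
Slope-bound (slope₁ ε b c u) =
  ℕ.≤-trans (ℕ.≤-reflexive (unit-abs ε (b ℕ.+ c) u)) (ℕ.m≤n+m _ _)
Slope-bound (slope₂ ε a c u) =
  ℕ.≤-trans (ℕ.≤-reflexive (unit-abs ε (a ℕ.+ c) u)) (ℕ.m≤m+n _ _)
Slope-bound (slope₃ ε a b u) = ℕ.≤-reflexive (trans (ℕ.+-comm a b)
  (cong₂ ℕ._+_ (unit-abs ε b u) (trans (unit-abs ε a u) abs-neg)))
  where
  abs-neg : ℤ.∣ ε ℤ.* + a ∣ ≡ ℤ.∣ ε ℤ.* ℤ.- + a ∣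
  abs-neg = trans (sym (ℤ.∣-i∣≡∣i∣ (ε ℤ.* + a))) (cong ℤ.∣_∣ (ℤ.neg-distribʳ-* ε (+ a)))

Positive : ℕ × ℕ × ℕ → Set
Positive D = ∀ i → 0 < coord i D

-- Coordinate j is the sum of the other two, so it is at least coordinate i; the new value adds a
-- positive number to coordinate j.
tropicalMove-increasing : ∀ {i j D v} → i ≢ j → Slope j D v → Positive D →
  coord i D < coord i (tropicalMove i D)
tropicalMove-increasing {m₁} i≢j (slope₁ _ _ _ _) _ = contradiction refl i≢j
tropicalMove-increasing {m₂} i≢j (slope₂ _ _ _ _) _ = contradiction refl i≢j
tropicalMove-increasing {m₃} i≢j (slope₃ _ _ _ _) _ = contradiction refl i≢j
tropicalMove-increasing {m₂} i≢j (slope₁ ε b c u) pos =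
  ℕ.≤-<-trans (ℕ.m≤m+n b c) (ℕ.m<m+n (b ℕ.+ c) (pos m₃))
tropicalMove-increasing {m₃} i≢j (slope₁ ε b c u) pos =
  ℕ.≤-<-trans (ℕ.m≤n+m c b) (ℕ.m<m+n (b ℕ.+ c) (pos m₂))
tropicalMove-increasing {m₁} i≢j (slope₂ ε a c u) pos =
  ℕ.≤-<-trans (ℕ.m≤m+n a c) (ℕ.m<m+n (a ℕ.+ c) (pos m₃))
tropicalMove-increasing {m₃} i≢j (slope₂ ε a c u) pos =
  ℕ.≤-<-trans (ℕ.m≤n+m c a) (ℕ.m<n+m (a ℕ.+ c) (pos m₁))
tropicalMove-increasing {m₁} i≢j (slope₃ ε a b u) pos =
  ℕ.≤-<-trans (ℕ.m≤m+n a b) (ℕ.m<n+m (a ℕ.+ b) (pos m₂))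
tropicalMove-increasing {m₂} i≢j (slope₃ ε a b u) pos =
  ℕ.≤-<-trans (ℕ.m≤n+m b a) (ℕ.m<n+m (a ℕ.+ b) (pos m₁))

tropicalMove-monotone : ∀ i D → coord i D < coord i (tropicalMove i D) →
  ∀ k → coord k D ≤ coord k (tropicalMove i D)
tropicalMove-monotone m₁ D lt m₁ = ℕ.<⇒≤ lt
tropicalMove-monotone m₁ D lt m₂ = ℕ.≤-refl
tropicalMove-monotone m₁ D lt m₃ = ℕ.≤-refl
tropicalMove-monotone m₂ D lt m₁ = ℕ.≤-refl
tropicalMove-monotone m₂ D lt m₂ = ℕ.<⇒≤ lt
tropicalMove-monotone m₂ D lt m₃ = ℕ.≤-refl
tropicalMove-monotone m₃ D lt m₁ = ℕ.≤-refl
tropicalMove-monotone m₃ D lt m₂ = ℕ.≤-refl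
tropicalMove-monotone m₃ D lt m₃ = ℕ.<⇒≤ lt

module Degrees {j D v} (slope : Slope j D v) (pos : Positive D) where

  mutual
    -- Mutual induction: monotonicity keeps all degrees positive, positivity makes the next step
    -- strictly increasing, and that step extends monotonicity to the longer word.
    degrees-monotone : ∀ {i w} → Path j i w → ∀ k → coord k D ≤ coord k (degrees D w)
    degrees-monotone []        k = ℕ.≤-refl
    degrees-monotone {w = i ∷ w} (i≢l ∷ P) k = ℕ.≤-trans (degrees-monotone P k)
      (tropicalMove-monotone i (degrees D w) (degrees-step i≢l P) k)

    degrees-step : ∀ {i l w} → i ≢ l → Path j l w →
      coord i (degrees D w) < coord i (tropicalMove i (degrees D w))
    degrees-step i≢l P = tropicalMove-increasing i≢l (Slope-path slope P)
      λ k → ℕ.≤-trans (pos k) (degrees-monotone P k)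

  -- This is what keeps the leading term when the starting coordinate is subtracted from the final
  -- one.
  degrees-< : ∀ {i w} → Path j i (i ∷ w) → coord i D < coord i (degrees D (i ∷ w))
  degrees-< {i} (i≢l ∷ P) = ℕ.≤-<-trans (degrees-monotone P i) (degrees-step i≢l P)

-- Bounds in terms of the matrix entries

maxEntry-resp : ∀ {A B} → A ≈P B → maxEntry A ≡ maxEntry B
maxEntry-resp {gl (mat _ _ _ _) _} {gl (mat _ _ _ _) _} (same refl) = refl
maxEntry-resp {gl (mat _ _ _ _) _} {gl (mat a b c d) _} (opposite refl)
  rewrite ℤ.∣-i∣≡∣i∣ a | ℤ.∣-i∣≡∣i∣ b | ℤ.∣-i∣≡∣i∣ c | ℤ.∣-i∣≡∣i∣ d = refl

maxEntry-bound : ∀ A s t → let (s′ , t′) = matrix A ·ᵥ (s , t) in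
  ℤ.∣ s′ ∣ ℕ.+ ℤ.∣ t′ ∣ ≤
    maxEntry A ℕ.* (ℤ.∣ s ∣ ℕ.+ ℤ.∣ t ∣) ℕ.+ maxEntry A ℕ.* (ℤ.∣ s ∣ ℕ.+ ℤ.∣ t ∣)
maxEntry-bound A@(gl (mat a b c d) _) s t = ℕ.+-mono-≤
  (row a b (ℕ.≤-trans (ℕ.m≤m⊔n _ _) ab≤N) (ℕ.≤-trans (ℕ.m≤n⊔m ℤ.∣ a ∣ _) ab≤N))
  (row c d (ℕ.≤-trans (ℕ.m≤n⊔m (ℤ.∣ a ∣ ⊔ ℤ.∣ b ∣) _) (ℕ.m≤m⊔n _ ℤ.∣ d ∣))
           (ℕ.m≤n⊔m (ℤ.∣ a ∣ ⊔ ℤ.∣ b ∣ ⊔ ℤ.∣ c ∣) _))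
  where
  N = maxEntry A
  ab≤N : ℤ.∣ a ∣ ⊔ ℤ.∣ b ∣ ≤ N
  ab≤N = ℕ.≤-trans (ℕ.m≤m⊔n _ ℤ.∣ c ∣) (ℕ.m≤m⊔n _ ℤ.∣ d ∣)
  row : ∀ x y → ℤ.∣ x ∣ ≤ N → ℤ.∣ y ∣ ≤ N →
        ℤ.∣ x ℤ.* s ℤ.+ y ℤ.* t ∣ ≤ N ℕ.* (ℤ.∣ s ∣ ℕ.+ ℤ.∣ t ∣)
  row x y x≤N y≤N = begin
    ℤ.∣ x ℤ.* s ℤ.+ y ℤ.* t ∣                     ≤⟨ ℤ.∣i+j∣≤∣i∣+∣j∣ (x ℤ.* s) (y ℤ.* t) ⟩
    ℤ.∣ x ℤ.* s ∣ ℕ.+ ℤ.∣ y ℤ.* t ∣               ≡⟨ cong₂ ℕ._+_ (ℤ.abs-* x s) (ℤ.abs-* y t) ⟩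
    ℤ.∣ x ∣ ℕ.* ℤ.∣ s ∣ ℕ.+ ℤ.∣ y ∣ ℕ.* ℤ.∣ t ∣   ≤⟨ ℕ.+-mono-≤ (ℕ.*-monoˡ-≤ ℤ.∣ s ∣ x≤N)
                                                                 (ℕ.*-monoˡ-≤ ℤ.∣ t ∣ y≤N) ⟩
    N ℕ.* ℤ.∣ s ∣ ℕ.+ N ℕ.* ℤ.∣ t ∣               ≡⟨ ℕ.*-distribˡ-+ N _ _ ⟨
    N ℕ.* (ℤ.∣ s ∣ ℕ.+ ℤ.∣ t ∣)                   ∎
    where open ℕ.≤-Reasoning

-- Counting

-- A cardinality bound expressed through duplicate-free lists, so that arbitrary predicates can be
-- counted by filtering and mapping lists.
AtMost : ∀ {T : Set} → ℕ → (T → Set) → Set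
AtMost n P = ∀ {xs} → Unique xs → All P xs → length xs ≤ n

module _ {T : Set} where

  AtMost-empty : ∀ {n} {P : T → Set} → (∀ {t} → ¬ P t) → AtMost n P
  AtMost-empty ¬P []      []       = z≤n
  AtMost-empty ¬P (_ ∷ _) (pt ∷ _) = contradiction pt ¬P

  length-filter-∁ : ∀ {P : T → Set} (P? : Decidable P) xs →
    length xs ≡ length (filter P? xs) ℕ.+ length (filter (¬? ∘ P?) xs)
  length-filter-∁ P? []       = refl
  length-filter-∁ P? (x ∷ xs) with P? x
  ... | yes _ = cong suc (length-filter-∁ P? xs)
  ... | no _  = trans (cong suc (length-filter-∁ P? xs)) (sym (ℕ.+-suc _ _))

  AtMost-split : ∀ {m n} {P Q : T → Set} → Decidable Q →
    AtMost m (λ t → P t × Q t) → AtMost n (λ t → P t × ¬ Q t) → AtMost (m ℕ.+ n) P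
  AtMost-split Q? PQ≤m P¬Q≤n {xs} xs! pxs = ℕ.≤-trans (ℕ.≤-reflexive (length-filter-∁ Q? xs))
    (ℕ.+-mono-≤ (PQ≤m  (Unique.filter⁺ Q? xs!)
                       (All.zip (All.filter⁺ Q? pxs , All.all-filter Q? xs)))
                (P¬Q≤n (Unique.filter⁺ (¬? ∘ Q?) xs!)
                       (All.zip (All.filter⁺ (¬? ∘ Q?) pxs , All.all-filter (¬? ∘ Q?) xs))))

  AtMost-fibres : ∀ {p n} {P : T → Set} (key : T → Fin p) →
    (∀ k → AtMost n (λ t → P t × key t ≡ k)) → AtMost (p ℕ.* n) P
  AtMost-fibres {p} {n} {P} key fibre≤n {xs} xs! pxs = subst (λ m → length xs ≤ m ℕ.* n)
    (length-tabulate {n = p} id) (bound (allFin p) xs! (All.map (λ pt → pt , ∈-allFin _) pxs))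
    where
    -- The induction runs over an arbitrary list of allowed keys; `allFin p`, of length p, is the
    -- case of interest.
    bound : ∀ ks → AtMost (length ks ℕ.* n) (λ t → P t × key t ∈ ks)
    bound [] = AtMost-empty λ { (_ , ()) }
    bound (k ∷ ks) = AtMost-split (λ t → key t Fin.≟ k)
      (λ ys! pys → fibre≤n k ys! (All.map (λ ((pt , _) , e) → pt , e) pys))
      (λ ys! pys → bound ks ys! (All.map other pys))
      where
      other : ∀ {t} → (P t × key t ∈ k ∷ ks) × key t ≢ k → P t × key t ∈ ks
      other ((pt , here e)  , ne) = contradiction e ne
      other ((pt , there m) , _)  = pt , m

  -- On P the map `rec` is a left inverse of `val`, so `val` is injective there and sends
  -- duplicate-free lists to duplicate-free lists.
  AtMost-section : ∀ {V : Set} {n} {P : T → Set} {Q : V → Set} (val : T → V) (rec : V → T) →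
    (∀ {t} → P t → rec (val t) ≡ t × Q (val t)) → AtMost n Q → AtMost n P
  AtMost-section {P = P} val rec h Q≤n {xs} xs! pxs = subst (_≤ _) (length-map val xs)
    (Q≤n (Unique.map⁻ {f = rec} (subst Unique (sym (retract pxs)) xs!))
         (All.map⁺ (All.map (proj₂ ∘ h) pxs)))
    where
    retract : ∀ {ys} → All P ys → map rec (map val ys) ≡ ys
    retract []         = refl
    retract (pt ∷ pts) = cong₂ _∷_ (proj₁ (h pt)) (retract pts)

-- Fixed points on the Markoff surface

module _ (p : ℕ) (p-prime : Prime p) where

  private instance
    p≢0 : NonZero p
    p≢0 = prime⇒nonZero p-prime

  open Residue p using (ι; ι-toℕ; toℕ-ι; ι-*ʳ; ι-+; ι-cong%)
  open CommutativeRing (𝔽 p) hiding (refl; sym; trans)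
  open RingProperties ring using (x≈y⇒x∙y⁻¹≈ε; +-inverseʳ-unique; -‿distribʳ-*; -‿involutive)

  private
    _≟_ = Fin._≟_ {p}

  1≢0 : 1# ≢ 0#
  1≢0 e = ℕ.1+n≢0 (trans (sym (m<n⇒m%n≡m 1<p)) (trans (sym (toℕ-ι 1))
    (trans (cong toℕ e) (trans (toℕ-ι 0) (m<n⇒m%n≡m (ℕ.<-trans ℕ.z<s 1<p))))))
    where
    1<p : 1 < p
    1<p = ℕ.nonTrivial⇒n>1 p {{prime⇒nonTrivial p-prime}}

  -- The inverse is made total, with default value `0#` at `0#`; elsewhere it comes from a Bézout
  -- identity for p and x.
  inverses : ∀ x → ∃[ y ] (x ≢ 0# → x * y ≡ 1#)
  inverses x with x ≟ 0#
  ... | yes x≡0 = 0# , contradiction x≡0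
  ... | no x≢0 with coprime-Bézout (prime⇒coprime p-prime {{ℕ.≢-nonZero toℕx≢0}} (Fin.toℕ<n x))
    where
    toℕx≢0 : toℕ x ≢ 0
    toℕx≢0 e = x≢0 (trans (sym (ι-toℕ x)) (cong ι e))
  -- Here 1 + b x = a p, so b inverts x only up to sign.
  ... | Bézout.+- a b eq = - ι b , λ _ → trans (sym (-‿distribʳ-* x (ι b)))
    (trans (cong -_ xb≡-1) (-‿involutive 1#))
    where
    xb≡-1 : x * ι b ≡ - 1#
    xb≡-1 = +-inverseʳ-unique 1# (x * ι b) (trans (cong (λ c → 1# + c) (ι-*ʳ x b)) (trans (ι-+ 1 _)
      (ι-cong% (trans (cong (ℕ._% p) (trans (cong (1 ℕ.+_) (ℕ.*-comm (toℕ x) b)) eq))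
                      (trans (m*n%n≡0 a p) (sym (m<n⇒m%n≡m (ℕ.>-nonZero⁻¹ p))))))))
  ... | Bézout.-+ a b eq = ι b , λ _ → trans (ι-*ʳ x b)
    (ι-cong% (trans (cong (ℕ._% p) (trans (ℕ.*-comm (toℕ x) b) (sym eq))) ([m+kn]%n≡m%n 1 a p)))

  infix 8 _⁻¹

  _⁻¹ : Fin p → Fin p
  x ⁻¹ = proj₁ (inverses x)

  ⁻¹-inverseʳ : ∀ {x} → x ≢ 0# → x * x ⁻¹ ≡ 1#
  ⁻¹-inverseʳ {x} = proj₂ (inverses x)

  ⁻¹-inverseˡ : ∀ {x} → x ≢ 0# → x ⁻¹ * x ≡ 1#
  ⁻¹-inverseˡ {x} x≢0 = trans (*-comm (x ⁻¹) x) (⁻¹-inverseʳ x≢0)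

  integral : ∀ {x y} → x * y ≡ 0# → x ≡ 0# ⊎ y ≡ 0#
  integral {x} {y} xy≡0 with x ≟ 0#
  ... | yes x≡0 = inj₁ x≡0
  ... | no x≢0  = inj₂ (begin
    y                 ≡⟨ *-identityʳ y ⟨
    y * 1#            ≡⟨ cong (y *_) (⁻¹-inverseʳ x≢0) ⟨
    y * (x * x ⁻¹)    ≡⟨ *-assoc y x (x ⁻¹) ⟨
    y * x * x ⁻¹      ≡⟨ cong (_* x ⁻¹) (trans (*-comm y x) xy≡0) ⟩
    0# * x ⁻¹         ≡⟨ zeroˡ (x ⁻¹) ⟩
    0#                ∎)
    where open ≡-Reasoning

  open PolynomialFunctions (𝔽 p)
  open Poles (𝔽 p) 1≢0 integral

  ⁻¹-≢0 : ∀ {x} → x ≢ 0# → x ⁻¹ ≢ 0#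
  ⁻¹-≢0 {x} x≢0 e = 1≢0 (trans (sym (⁻¹-inverseʳ x≢0)) (trans (cong (x *_) e) (zeroʳ x)))

  -- Fixed points along a curve with prescribed poles

  HasPoles : ℕ × ℕ × ℕ → (Fin p → Triple p) → Set
  HasPoles D T = ∀ i → HasPole (coord i D) (λ v → coord i (T v))

  HasPoles-move : ∀ {D T} i → coord i D < coord i (tropicalMove i D) →
    HasPoles D T → HasPoles (tropicalMove i D) (move p i ∘ T)
  HasPoles-move m₁ lt h m₁ = HasPole-minus lt (HasPole-* (h m₂) (h m₃)) (h m₁)
  HasPoles-move m₁ lt h m₂ = h m₂
  HasPoles-move m₁ lt h m₃ = h m₃
  HasPoles-move m₂ lt h m₁ = h m₁
  HasPoles-move m₂ lt h m₂ = HasPole-minus lt (HasPole-* (h m₁) (h m₃)) (h m₂)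
  HasPoles-move m₂ lt h m₃ = h m₃
  HasPoles-move m₃ lt h m₁ = h m₁
  HasPoles-move m₃ lt h m₂ = h m₂
  HasPoles-move m₃ lt h m₃ = HasPole-minus lt (HasPole-* (h m₁) (h m₂)) (h m₃)

  module _ {j D v} (slope : Slope j D v) (pos : Positive D) where

    open Degrees slope pos

    HasPoles-act : ∀ {T i w} → HasPoles D T → Path j i w → HasPoles (degrees D w) (act p w ∘ T)
    HasPoles-act h [] = h
    HasPoles-act {w = i ∷ w} h (i≢l ∷ P) = HasPoles-move i (degrees-step i≢l P) (HasPoles-act h P)

    -- Comparing coordinate i alone suffices: its final value has larger pole order than its initial
    -- one, so the difference has a pole of order exactly d, and its numerator has degree 2d.
    fixed-on-curve : ∀ {T i w} → HasPoles D T → Path j i (i ∷ w) →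
      let d = coord i (degrees D (i ∷ w)) in
      AtMost (d ℕ.+ d) (λ x → x ≢ 0# × act p (i ∷ w) (T x) ≡ T x)
    fixed-on-curve {T} {i} {w} h P xs! fixed = HasPole-roots
      (HasPole-minus (degrees-< P) (HasPoles-act h P i) (h i)) xs!
      (All.map (λ (x≢0 , e) → x≢0 , x≈y⇒x∙y⁻¹≈ε (cong (coord i) e)) fixed)

  -- Parametrisation of the triples with xyz ≠ 0

  -- With u = x/z and v = y/z, the Markoff equation reads u² + v² + 1 = zuv, so that
  -- x = (u² + v² + 1)/v.
  abscissa : Fin p → Fin p → Fin p
  abscissa u v = (v * v + (u * u + 1#)) * v ⁻¹

  HasPole-abscissa : ∀ u → HasPole 1 (abscissa u)
  HasPole-abscissa u = HasPole-quadratic (u * u + 1#) λ {v} v≢0 →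
    let w = v * v + (u * u + 1#) in begin
    w * v ⁻¹ * v     ≡⟨ *-assoc w (v ⁻¹) v ⟩
    w * (v ⁻¹ * v)   ≡⟨ cong (w *_) (⁻¹-inverseˡ v≢0) ⟩
    w * 1#           ≡⟨ *-identityʳ w ⟩
    w                ∎
    where open ≡-Reasoning

  -- These invert the passage to ratios through z = x/u and y = zv. In `curve₁` the roles of x and y
  -- are exchanged, so u = y/z and v = x/z. The index names the coordinate with the double pole.
  curve₂ curve₁ : Fin p → Fin p → Triple p
  curve₂ u v = abscissa u v , u ⁻¹ * (abscissa u v * v) , u ⁻¹ * abscissa u v
  curve₁ u v = u ⁻¹ * (abscissa u v * v) , abscissa u v , u ⁻¹ * abscissa u v

  curve₂-poles : ∀ {u} → u ≢ 0# → HasPoles (1 , 2 , 1) (curve₂ u)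
  curve₂-poles {u} u≢0 m₁ = HasPole-abscissa u
  curve₂-poles {u} u≢0 m₂ =
    HasPole-* (HasPole-const (⁻¹-≢0 u≢0)) (HasPole-* (HasPole-abscissa u) HasPole-x)
  curve₂-poles {u} u≢0 m₃ = HasPole-* (HasPole-const (⁻¹-≢0 u≢0)) (HasPole-abscissa u)

  curve₁-poles : ∀ {u} → u ≢ 0# → HasPoles (2 , 1 , 1) (curve₁ u)
  curve₁-poles u≢0 m₁ = curve₂-poles u≢0 m₂
  curve₁-poles u≢0 m₂ = curve₂-poles u≢0 m₁
  curve₁-poles u≢0 m₃ = curve₂-poles u≢0 m₃

  module _ {x y z} (x≢0 : x ≢ 0#) (y≢0 : y ≢ 0#) (z≢0 : z ≢ 0#)
           (markoff : x * x + y * y + z * z ≡ x * y * z) where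

    private
      u = x * z ⁻¹
      v = y * z ⁻¹

    open SemiringSolver commutativeSemiring
    open ≡-Reasoning

    ratio-≢0 : ∀ {x} → x ≢ 0# → x * z ⁻¹ ≢ 0#
    ratio-≢0 x≢0 = *-≉0 x≢0 (⁻¹-≢0 z≢0)

    ratio-* : ∀ x → x * z ⁻¹ * z ≡ x
    ratio-* x = begin
      x * z ⁻¹ * z     ≡⟨ *-assoc x (z ⁻¹) z ⟩
      x * (z ⁻¹ * z)   ≡⟨ cong (x *_) (⁻¹-inverseˡ z≢0) ⟩
      x * 1#           ≡⟨ *-identityʳ x ⟩
      x                ∎

    abscissa-ratio : abscissa u v ≡ x
    abscissa-ratio = begin
      (v * v + (u * u + 1#)) * v ⁻¹
        -- Replacing 1 by (z / z)² homogenises the numerator, so that the Markoff equation applies.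
        ≡⟨ cong (λ c → (v * v + (u * u + c)) * v ⁻¹)
                (trans (sym (*-identityʳ 1#)) (cong₂ _*_ (sym zi≡1) (sym zi≡1))) ⟩
      (v * v + (u * u + (z * i) * (z * i))) * v ⁻¹
        ≡⟨ cong (_* v ⁻¹) (solve 4 (λ x y z i →
             (y :* i) :* (y :* i) :+ ((x :* i) :* (x :* i) :+ (z :* i) :* (z :* i))
             := (x :* x :+ y :* y :+ z :* z) :* (i :* i)) refl x y z i) ⟩
      (x * x + y * y + z * z) * (i * i) * v ⁻¹
        ≡⟨ cong (λ c → c * (i * i) * v ⁻¹) markoff ⟩
      x * y * z * (i * i) * v ⁻¹
        ≡⟨ solve 5 (λ x y z i w → x :* y :* z :* (i :* i) :* w
                                  := x :* (z :* i) :* ((y :* i) :* w)) refl x y z i (v ⁻¹) ⟩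
      x * (z * i) * (v * v ⁻¹)
        ≡⟨ cong₂ (λ a b → x * a * b) zi≡1 (⁻¹-inverseʳ (ratio-≢0 y≢0)) ⟩
      x * 1# * 1#
        ≡⟨ trans (*-identityʳ _) (*-identityʳ x) ⟩
      x ∎
      where
      i = z ⁻¹
      zi≡1 : z * i ≡ 1#
      zi≡1 = ⁻¹-inverseʳ z≢0

    u⁻¹x≡z : u ⁻¹ * x ≡ z
    u⁻¹x≡z = begin
      u ⁻¹ * x         ≡⟨ cong (u ⁻¹ *_) (ratio-* x) ⟨
      u ⁻¹ * (u * z)   ≡⟨ *-assoc (u ⁻¹) u z ⟨
      u ⁻¹ * u * z     ≡⟨ cong (_* z) (⁻¹-inverseˡ (ratio-≢0 x≢0)) ⟩
      1# * z           ≡⟨ *-identityˡ z ⟩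
      z                ∎

    curve₂-ratio : curve₂ u v ≡ (x , y , z)
    curve₂-ratio = cong₂ _,_ abscissa-ratio (cong₂ _,_
      (begin
        u ⁻¹ * (abscissa u v * v)   ≡⟨ cong (λ a → u ⁻¹ * (a * v)) abscissa-ratio ⟩
        u ⁻¹ * (x * v)              ≡⟨ *-assoc (u ⁻¹) x v ⟨
        u ⁻¹ * x * v                ≡⟨ cong (_* v) u⁻¹x≡z ⟩
        z * v                       ≡⟨ *-comm z v ⟩
        v * z                       ≡⟨ ratio-* y ⟩
        y                           ∎)
      (trans (cong (u ⁻¹ *_) abscissa-ratio) u⁻¹x≡z))

  -- Counting fixed points, inside and on the coordinate planes

  Fixed : Word → Triple p → Set
  Fixed g t = IsMarkoff p t × act p g t ≡ t

  Interior : Triple p → Set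
  Interior (x , y , z) = x ≢ 0# × y ≢ 0# × z ≢ 0#

  swapped : ∀ x y z → x * x + y * y + z * z ≡ x * y * z → y * y + x * x + z * z ≡ y * x * z
  swapped x y z e = trans (cong (_+ z * z) (+-comm (y * y) (x * x)))
    (trans e (cong (_* z) (*-comm x y)))

  curve₁-ratio : ∀ {x y z} → x ≢ 0# → y ≢ 0# → z ≢ 0# →
    x * x + y * y + z * z ≡ x * y * z → curve₁ (y * z ⁻¹) (x * z ⁻¹) ≡ (x , y , z)
  curve₁-ratio {x} {y} {z} x≢0 y≢0 z≢0 markoff =
    cong (λ (y , x , z) → x , y , z) (curve₂-ratio y≢0 x≢0 z≢0 (swapped x y z markoff))

  -- For each value of `key`, the interior fixed points embed through `val` into the fixed
  -- parameters of one curve.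
  interior : ∀ {d} g (key val : Triple p → Fin p) (curve : Fin p → Fin p → Triple p) →
    (∀ {t} → IsMarkoff p t → Interior t → key t ≢ 0# × val t ≢ 0# × curve (key t) (val t) ≡ t) →
    (∀ {u} → u ≢ 0# → AtMost d (λ v → v ≢ 0# × act p g (curve u v) ≡ curve u v)) →
    AtMost (p ℕ.* d) (λ t → Fixed g t × Interior t)
  interior {d} g key val curve on-curve curve≤d = AtMost-fibres key fibre
    where
    fibre : ∀ u → AtMost d (λ t → (Fixed g t × Interior t) × key t ≡ u)
    -- The curve bound requires u ≠ 0, which is read off from a point of the fibre; the empty list
    -- is therefore treated apart.
    fibre u [] [] = z≤n
    fibre u xs! pts@((((markoff , _) , int) , key≡u) ∷ _) =
      AtMost-section val (curve u)
        (λ (((markoff , fixed) , int) , key≡u) →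
          let _ , v≢0 , e = on-curve markoff int
              e′ = trans (cong (λ k → curve k _) (sym key≡u)) e in
          e′ , v≢0 , trans (cong (act p g) e′) (trans fixed (sym e′)))
        (curve≤d (subst (_≢ 0#) key≡u (proj₁ (on-curve markoff int)))) xs! pts

  square-roots : ∀ c → AtMost 2 (λ v → v * v + c ≡ 0#)
  square-roots c = Poly-roots (Poly-quadratic c) 1≢0

  -- With x = 0 the equation becomes y² + z² = 0, which leaves at most two values of z for each y.
  -- The other two planes are similar.
  x≡0-line : AtMost (p ℕ.* 2) (λ t → IsMarkoff p t × coord m₁ t ≡ 0#)
  x≡0-line = AtMost-fibres (coord m₂) λ u → AtMost-section (coord m₃) (λ v → 0# , u , v)
    (λ { {x , y , z} (((_ , e) , refl) , refl) → refl , (begin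
      z * z + y * y               ≡⟨ +-comm (z * z) (y * y) ⟩
      y * y + z * z               ≡⟨ solve 2 (λ y z → y :* y :+ z :* z
                                       := con 0 :* con 0 :+ y :* y :+ z :* z) refl y z ⟩
      0# * 0# + y * y + z * z     ≡⟨ e ⟩
      0# * y * z                  ≡⟨ solve 2 (λ y z → con 0 :* y :* z := con 0) refl y z ⟩
      0#                          ∎) })
    (square-roots (u * u))
    where
    open SemiringSolver commutativeSemiring
    open ≡-Reasoning

  y≡0-line : AtMost (p ℕ.* 2) (λ t → IsMarkoff p t × coord m₂ t ≡ 0#)
  y≡0-line = AtMost-fibres (coord m₁) λ u → AtMost-section (coord m₃) (λ v → u , 0# , v)
    (λ { {x , y , z} (((_ , e) , refl) , refl) → refl , (begin
      z * z + x * x               ≡⟨ solve 2 (λ x z → z :* z :+ x :* x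
                                       := x :* x :+ con 0 :* con 0 :+ z :* z) refl x z ⟩
      x * x + 0# * 0# + z * z     ≡⟨ e ⟩
      x * 0# * z                  ≡⟨ solve 2 (λ x z → x :* con 0 :* z := con 0) refl x z ⟩
      0#                          ∎) })
    (square-roots (u * u))
    where
    open SemiringSolver commutativeSemiring
    open ≡-Reasoning

  z≡0-line : AtMost (p ℕ.* 2) (λ t → IsMarkoff p t × coord m₃ t ≡ 0#)
  z≡0-line = AtMost-fibres (coord m₁) λ u → AtMost-section (coord m₂) (λ v → u , v , 0#)
    (λ { {x , y , z} (((_ , e) , refl) , refl) → refl , (begin
      y * y + x * x               ≡⟨ solve 2 (λ x y → y :* y :+ x :* x
                                       := x :* x :+ y :* y :+ con 0 :* con 0) refl x y ⟩
      x * x + y * y + 0# * 0#     ≡⟨ e ⟩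
      x * y * 0#                  ≡⟨ zeroʳ (x * y) ⟩
      0#                          ∎) })
    (square-roots (u * u))
    where
    open SemiringSolver commutativeSemiring
    open ≡-Reasoning

  -- Each coordinate plane costs at most 2p points, and the triples off all three planes are the
  -- interior ones.
  fixed≤ : ∀ {d} g → AtMost (p ℕ.* d) (λ t → Fixed g t × Interior t) →
    AtMost (p ℕ.* 2 ℕ.+ (p ℕ.* 2 ℕ.+ (p ℕ.* 2 ℕ.+ p ℕ.* d))) (Fixed g)
  fixed≤ g interior≤ =
    AtMost-split (λ t → coord m₁ t ≟ 0#)
      (weaken (λ ((m , _) , x≡0) → m , x≡0) x≡0-line)
      (AtMost-split (λ t → coord m₂ t ≟ 0#)
        (weaken (λ (((m , _) , _) , y≡0) → m , y≡0) y≡0-line)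
        (AtMost-split (λ t → coord m₃ t ≟ 0#)
          (weaken (λ ((((m , _) , _) , _) , z≡0) → m , z≡0) z≡0-line)
          (weaken (λ (((f , x≢0) , y≢0) , z≢0) → f , x≢0 , y≢0 , z≢0) interior≤)))
    where
    weaken : ∀ {n} {P Q : Triple p → Set} → (∀ {t} → P t → Q t) → AtMost n Q → AtMost n P
    weaken P⇒Q Q≤n xs! pxs = Q≤n xs! (All.map P⇒Q pxs)

  -- (2 , 1) and (1 , 2) are the vectors (s , t) of the degrees (1 , 2 , 1) and (2 , 1 , 1).
  fixed-path≤ : ∀ i w → Path m₁ i (i ∷ w) ⊎ Path m₂ i (i ∷ w) →
    ∃[ d ] 0 < d × d ≤ maxEntry (ρ (i ∷ w)) ℕ.* 3 ℕ.+ maxEntry (ρ (i ∷ w)) ℕ.* 3 ×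
      AtMost (p ℕ.* 2 ℕ.+ (p ℕ.* 2 ℕ.+ (p ℕ.* 2 ℕ.+ p ℕ.* (d ℕ.+ d)))) (Fixed (i ∷ w))
  fixed-path≤ i w (inj₁ P) = coord i (degrees (2 , 1 , 1) (i ∷ w))
    , ℕ.≤-<-trans z≤n (degrees-< P)
    -- The factor 3 is |s| + |t| for the starting vector (1 , 2).
    , ℕ.≤-trans (Slope-bound (Slope-path start P)) (maxEntry-bound (ρ (i ∷ w)) (+ 1) (+ 2))
    , fixed≤ (i ∷ w) (interior (i ∷ w)
        -- A path from m₁ needs the largest starting degree at x, which is the case on `curve₁`.
        (λ (x , y , z) → y * z ⁻¹) (λ (x , y , z) → x * z ⁻¹) curve₁
        (λ (_ , e) (x≢0 , y≢0 , z≢0) → *-≉0 y≢0 (⁻¹-≢0 z≢0) , *-≉0 x≢0 (⁻¹-≢0 z≢0)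
                                       , curve₁-ratio x≢0 y≢0 z≢0 e)
        (λ u≢0 → fixed-on-curve start pos (curve₁-poles u≢0) P))
    where
    start : Slope m₁ (2 , 1 , 1) (+ 1 , + 2)
    start = slope₁ (+ 1) 1 1 refl
    pos : Positive (2 , 1 , 1)
    pos = λ { m₁ → ℕ.z<s ; m₂ → ℕ.z<s ; m₃ → ℕ.z<s }
    open Degrees start pos
  fixed-path≤ i w (inj₂ P) = coord i (degrees (1 , 2 , 1) (i ∷ w))
    , ℕ.≤-<-trans z≤n (degrees-< P)
    , ℕ.≤-trans (Slope-bound (Slope-path start P)) (maxEntry-bound (ρ (i ∷ w)) (+ 2) (+ 1))
    , fixed≤ (i ∷ w) (interior (i ∷ w)
        (λ (x , y , z) → x * z ⁻¹) (λ (x , y , z) → y * z ⁻¹) curve₂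
        (λ (_ , e) (x≢0 , y≢0 , z≢0) → *-≉0 x≢0 (⁻¹-≢0 z≢0) , *-≉0 y≢0 (⁻¹-≢0 z≢0)
                                       , curve₂-ratio x≢0 y≢0 z≢0 e)
        (λ u≢0 → fixed-on-curve start pos (curve₂-poles u≢0) P))
    where
    start : Slope m₂ (1 , 2 , 1) (+ 2 , + 1)
    start = slope₂ (+ 1) 1 1 refl
    pos : Positive (1 , 2 , 1)
    pos = λ { m₁ → ℕ.z<s ; m₂ → ℕ.z<s ; m₃ → ℕ.z<s }
    open Degrees start pos

  -- Equal group elements act identically, so a bound for the reduced word carries over to g.
  #fixedPoints≤ : ∀ {n g w} → g ≈G w → AtMost n (Fixed w) → #fixedPoints p g ≤ n
  #fixedPoints≤ {g = g} g≈w Fw≤n = Fw≤n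
    (Unique.filter⁺ fixed? (Unique.cartesianProduct⁺ (Unique.allFin⁺ p)
      (Unique.cartesianProduct⁺ (Unique.allFin⁺ p) (Unique.allFin⁺ p))))
    (All.map (λ {t} (m , e) → m , trans (sym (act-cong p g≈w t)) e)
             (All.all-filter fixed? (triples p)))
    where
    fixed? : Decidable (Fixed g)
    fixed? t = IsMarkoff? p t ×-dec _≟T_ p (act p g t) t

-- As d ≥ 1, 6p + 2pd ≤ 8pd ≤ 48pN, and N ≤ N ^ 8. The case N = 0 contradicts 0 < d ≤ 6N.
bound-arithmetic : ∀ p d N → 0 < d → d ≤ N ℕ.* 3 ℕ.+ N ℕ.* 3 →
  p ℕ.* 2 ℕ.+ (p ℕ.* 2 ℕ.+ (p ℕ.* 2 ℕ.+ p ℕ.* (d ℕ.+ d))) ≤ 1024 ℕ.* p ℕ.* N ℕ.^ 8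
bound-arithmetic p d       zero       0<d d≤6N = contradiction d≤6N (ℕ.<⇒≱ 0<d)
bound-arithmetic p d@(suc _) N@(suc _) 0<d d≤6N = begin
  p ℕ.* 2 ℕ.+ (p ℕ.* 2 ℕ.+ (p ℕ.* 2 ℕ.+ p ℕ.* (d ℕ.+ d)))
    ≡⟨ lem₁ p d ⟩
  p ℕ.* (6 ℕ.+ (d ℕ.+ d))
    ≤⟨ ℕ.*-monoʳ-≤ p (ℕ.+-monoˡ-≤ (d ℕ.+ d) (ℕ.m≤m*n 6 d)) ⟩
  p ℕ.* (6 ℕ.* d ℕ.+ (d ℕ.+ d))
    ≡⟨ lem₂ p d ⟩
  p ℕ.* (8 ℕ.* d)
    ≤⟨ ℕ.*-monoʳ-≤ p (ℕ.*-monoʳ-≤ 8 d≤6N) ⟩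
  p ℕ.* (8 ℕ.* (N ℕ.* 3 ℕ.+ N ℕ.* 3))
    ≡⟨ lem₃ p N ⟩
  48 ℕ.* (p ℕ.* N)
    ≤⟨ ℕ.*-monoˡ-≤ (p ℕ.* N) (ℕ.m≤m+n 48 976) ⟩
  1024 ℕ.* (p ℕ.* N)
    ≡⟨ ℕ.*-assoc 1024 p N ⟨
  1024 ℕ.* p ℕ.* N
    ≤⟨ ℕ.*-monoʳ-≤ (1024 ℕ.* p) (ℕ.m≤m*n N (N ℕ.^ 7) {{ℕ.m^n≢0 N 7}}) ⟩
  1024 ℕ.* p ℕ.* N ℕ.^ 8 ∎
  where
  open ℕ.≤-Reasoning
  lem₁ : ∀ p d → p ℕ.* 2 ℕ.+ (p ℕ.* 2 ℕ.+ (p ℕ.* 2 ℕ.+ p ℕ.* (d ℕ.+ d))) ≡ p ℕ.* (6 ℕ.+ (d ℕ.+ d))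
  lem₁ = ℕ-Solver.solve-∀
  lem₂ : ∀ p d → p ℕ.* (6 ℕ.* d ℕ.+ (d ℕ.+ d)) ≡ p ℕ.* (8 ℕ.* d)
  lem₂ = ℕ-Solver.solve-∀
  lem₃ : ∀ p N → p ℕ.* (8 ℕ.* (N ℕ.* 3 ℕ.+ N ℕ.* 3)) ≡ 48 ℕ.* (p ℕ.* N)
  lem₃ = ℕ-Solver.solve-∀

open import Data.Nat.Base using (_*_; _^_)

theorem6p1 : (p : ℕ) (p-prime : Prime p) → ¬ (2 ∣ p) →
    (g : Group.Carrier G) → ¬ (Group._≈_ G g (Group.ε G)) →
    (A : GL₂ℤ) → g RepresentedBy A →
    128 * maxEntry A ^ 8 ≤ p →
    #fixedPoints p {{prime⇒nonZero p-prime}} g ≤ 1024 * p * maxEntry A ^ 8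
theorem6p1 p p-prime _ g g≉ε A ρg≈A _ with reduced-form g
... | []    , _       , g≈w = contradiction g≈w g≉ε
... | i ∷ w , reduced , g≈w with fixed-path≤ p p-prime i w (reduced⇒path reduced)
... | d , 0<d , d≤6N , fixed≤d =
  ℕ.≤-trans (#fixedPoints≤ p p-prime g≈w fixed≤d)
    (bound-arithmetic p d (maxEntry A) 0<d
      -- A and the matrix of the reduced word agree up to sign, which `maxEntry` does not see.
      (subst (λ N → d ≤ N * 3 ℕ.+ N * 3)
             (maxEntry-resp (≈P.trans (≈P.sym (ρ-cong g≈w)) ρg≈A)) d≤6N))
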